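{- For all integers $n,R\ge 0$, $K^+(n,R)\le (n\log 2+1)\,\nu(n,R)$, where $$\nu(n,R)=\sum_{j=0}^n\frac{\binom{n}{j}}{\sum_{i=0}^R\binom{n-j}{i}}$$ and $\log$ is the natural logarithm.
   Context: $Q_n=\{0,1\}^n$ is ordered by $x\preceq y$ iff $x_i\le y_i$ for all $i$, and $d(x,y)$ is the Hamming distance. The downward directed ball is $B_n^-(x,R)=\{y\in Q_n: y\preceq x,\ d(x,y)\le R\}$. A set $\mathcal{C}\subseteq Q_n$ downward $R$-covers $Q_n$ if $Q_n=\bigcup_{c\in\mathcal{C}}B_n^-(c,R)$. $K^+(n,R)$ denotes the minimum size of a set $\mathcal{C}\subseteq Q_n$ that downward $R$-covers $Q_n$ (in particular $K^+(n,R)=1$ for $R\ge n$). The quantity $\sum_{i=0}^R\binom{n-j}{i}$ is the size of the upward directed ball $\{y\in Q_n: x\preceq y,\ d(x,y)\le R\}$ around any $x$ having exactly $j$ ones. -}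

module Defs where

open import Algebra.Bundles using (CommutativeRing)
open import Data.Bool using (Bool; true; false)
import Data.Bool as Bool
import Data.Bool.Properties as Bool
open import Data.Empty using (⊥-elim)
open import Data.Fin using (Fin; zero; suc; toℕ)
import Data.Fin.Properties as Fin
open import Data.Integer using (+_)
import Data.Integer as ℤ
import Data.Integer.Properties as ℤ
open import Data.List using (List; []; _∷_; length; cartesianProductWith)
open import Data.List.Membership.Propositional using (_∈_; find; lose)
open import Data.List.Membership.Propositional.Properties using (∈-cartesianProductWith⁺)
open import Data.List.Relation.Unary.All using ([]; _∷_)
import Data.List.Relation.Unary.All as All
open import Data.List.Relation.Unary.AllPairs using ([]; _∷_)
open import Data.List.Relation.Unary.Any using (Any; here; there; any?)
open import Data.List.Relation.Unary.Unique.Propositional using (Unique)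
import Data.List.Relation.Unary.Unique.Propositional.Properties as Unique
open import Data.Nat using (ℕ; zero; suc; NonZero)
import Data.Nat as ℕ
open import Data.Nat.Combinatorics using (_C_)
import Data.Nat.Properties as ℕ
open import Data.Product using (Σ; ∃; _×_; _,_; proj₁; proj₂)
open import Data.Rational hiding (NonZero)
import Data.Rational.Properties as ℚ
import Data.Rational.Unnormalised as ℚᵘ
import Data.Rational.Unnormalised.Properties as ℚᵘ
open import Data.Rational.Solver using (module +-*-Solver)
open import Data.Sum using (_⊎_; inj₁; inj₂)
open import Data.Vec using (Vec; []; _∷_; lookup; count; zip)
import Data.Vec.Properties as Vec
open import Function using (_∘_)
open import Relation.Binary.PropositionalEquality
open import Relation.Nullary using (¬_; Dec; yes; no; ¬?)
open import Relation.Nullary.Decidable using (map′; _×-dec_)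
open import Relation.Unary using (Pred; Decidable)
open import Level using (0ℓ)

import Algebra.Properties.Semiring.Sum ℕ.+-*-semiring as ℕ-Sum
import Algebra.Properties.Semiring.Sum
  (CommutativeRing.semiring ℚ.+-*-commutativeRing) as ℚ-Sum
import Data.List.Relation.Unary.Unique.DecPropositional as DecUnique

Q : ℕ → Set
Q n = Vec Bool n

infix 4 _≼_

_≼_ : ∀ {n} → Q n → Q n → Set
x ≼ y = ∀ i → lookup x i Bool.≤ lookup y i

d : ∀ {n} → Q n → Q n → ℕ
d x y = count (λ p → ¬? (proj₁ p Bool.≟ proj₂ p)) (zip x y)

B⁻ : ∀ {n} → Q n → ℕ → Pred (Q n) 0ℓ
B⁻ x R y = y ≼ x × d x y ℕ.≤ R

DownwardCovers : ∀ {n} → ℕ → List (Q n) → Set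
DownwardCovers R 𝒞 = ∀ y → Any (λ c → B⁻ c R y) 𝒞

-- Subsets of Q n are duplicate-free lists, so that size is length.
HasCoverOfSize : ℕ → ℕ → Pred ℕ 0ℓ
HasCoverOfSize n R k =
  Σ (List (Q n)) λ 𝒞 → length 𝒞 ≡ k × Unique 𝒞 × DownwardCovers R 𝒞

IsMinimum : Pred ℕ 0ℓ → Pred ℕ 0ℓ
IsMinimum P k = P k × (∀ m → P m → k ℕ.≤ m)

private
  minimum : {P : Pred ℕ 0ℓ} → Decidable P → ∃ P → ∃ (IsMinimum P)
  minimum {P} P? (n , pn) with search (suc n)
    where
    search : ∀ n → (∀ m → m ℕ.< n → ¬ P m) ⊎ ∃ (IsMinimum P)
    search zero = inj₁ λ _ ()
    search (suc n) with search n
    ... | inj₂ found = inj₂ found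
    ... | inj₁ none with P? n
    ...   | yes p = inj₂ (n , p , λ m pm → ℕ.≮⇒≥ λ m<n → none m m<n pm)
    ...   | no ¬p = inj₁ λ m m<1+n pm → go m m<1+n pm
      where
      go : ∀ m → m ℕ.< suc n → ¬ P m
      go m m<1+n pm with ℕ.m<1+n⇒m<n∨m≡n m<1+n
      ... | inj₁ m<n  = none m m<n pm
      ... | inj₂ refl = ¬p pm
  ... | inj₁ none  = ⊥-elim (none n ℕ.≤-refl pn)
  ... | inj₂ found = found

cube : ∀ n → List (Q n)
cube zero    = [] ∷ []
cube (suc n) = cartesianProductWith _∷_ (false ∷ true ∷ []) (cube n)

∈-cube : ∀ {n} (x : Q n) → x ∈ cube n
∈-cube []      = here refl
∈-cube (b ∷ x) = ∈-cartesianProductWith⁺ _∷_ (∈-bools b) (∈-cube x)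
  where
  ∈-bools : ∀ b → b ∈ false ∷ true ∷ []
  ∈-bools false = here refl
  ∈-bools true  = there (here refl)

cube-unique : ∀ n → Unique (cube n)
cube-unique zero    = [] ∷ []
cube-unique (suc n) = Unique.cartesianProductWith⁺ _∷_ Vec.∷-injective
  (((λ ()) ∷ []) ∷ [] ∷ []) (cube-unique n)

B⁻? : ∀ {n} (x : Q n) R → Decidable (B⁻ x R)
B⁻? x R y =
  Fin.all? (λ i → lookup y i Bool.≤? lookup x i) ×-dec (d x y ℕ.≤? R)

downwardCovers? : ∀ {n} R → Decidable (DownwardCovers {n} R)
downwardCovers? {n} R 𝒞 = map′
  (λ all y → All.lookup all (∈-cube y))
  (λ covers → All.tabulate λ {y} _ → covers y)
  (All.all? (λ y → any? (λ c → B⁻? c R y) 𝒞) (cube n))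

private
  AnyListOfLength : ∀ {n} → ℕ → Pred (List (Q n)) 0ℓ → Set
  AnyListOfLength {n} k P = Σ (List (Q n)) λ xs → length xs ≡ k × P xs

  anyListOfLength? : ∀ {n} {P : Pred (List (Q n)) 0ℓ} → Decidable P →
                     ∀ k → Dec (AnyListOfLength k P)
  anyListOfLength? P? zero = map′
    (λ p → [] , refl , p) (λ { ([] , _ , p) → p }) (P? [])
  anyListOfLength? {n} {P} P? (suc k) = map′ cons uncons
    (any? (λ x → anyListOfLength? (λ xs → P? (x ∷ xs)) k) (cube n))
    where
    Tail : Pred (Q n) 0ℓ
    Tail x = AnyListOfLength k (P ∘ (x ∷_))

    cons : Any Tail (cube n) → AnyListOfLength (suc k) P
    cons any = let (x , _ , xs , eq , p) = find any
               in x ∷ xs , cong suc eq , p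

    uncons : AnyListOfLength (suc k) P → Any Tail (cube n)
    uncons (x ∷ xs , eq , p) = lose (∈-cube x) (xs , ℕ.suc-injective eq , p)

hasCoverOfSize? : ∀ n R → Decidable (HasCoverOfSize n R)
hasCoverOfSize? n R =
  anyListOfLength? λ 𝒞 →
    DecUnique.unique? (Vec.≡-dec Bool._≟_) 𝒞 ×-dec downwardCovers? R 𝒞

cube-covers : ∀ n R → DownwardCovers R (cube n)
cube-covers n R y = lose (∈-cube y) ((λ _ → Bool.≤-refl) , y-near y)
  where
  d-refl : ∀ {n} (y : Q n) → d y y ≡ 0
  d-refl []          = refl
  d-refl (false ∷ y) = d-refl y
  d-refl (true  ∷ y) = d-refl y

  y-near : ∀ y → d y y ℕ.≤ R
  y-near y rewrite d-refl y = ℕ.z≤n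

minimumCover : ∀ n R → ∃ (IsMinimum (HasCoverOfSize n R))
minimumCover n R = minimum (hasCoverOfSize? n R)
  (length (cube n) , cube n , refl , cube-unique n , cube-covers n R)

K⁺ : ℕ → ℕ → ℕ
K⁺ n R = proj₁ (minimumCover n R)

-- The number of y with x ≼ y and d x y ≤ R, for x : Q n having j ones;
-- m C i is 0 for i > m.
upBallSize : ℕ → ℕ → ℕ → ℕ
upBallSize n R j = ℕ-Sum.∑[ i ≤ R ] ((n ℕ.∸ j) C toℕ i)

ν : ℕ → ℕ → ℚ
ν n R = ℚ-Sum.∑[ j ≤ n ] (+ (n C toℕ j) / upBallSize n R (toℕ j))

fromℕ : ℕ → ℚ
fromℕ n = + n / 1

open +-*-Solver using (solve; _:+_; _:*_; _:-_; :-_; _:=_; con)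
open ℚ.≤-Reasoning

private
  half-sum : ∀ p → ½ * p + ½ * p ≡ p
  half-sum = solve 1 (λ p → con ½ :* p :+ con ½ :* p := p) refl

  *-mono-≤ : ∀ {a b c d} → 0ℚ ≤ b → 0ℚ ≤ c → a ≤ b → c ≤ d → a * c ≤ b * d
  *-mono-≤ {a} {b} {c} {d} 0≤b 0≤c a≤b c≤d = begin
    a * c  ≤⟨ ℚ.*-monoʳ-≤-nonNeg c {{nonNegative 0≤c}} a≤b ⟩
    b * c  ≤⟨ ℚ.*-monoˡ-≤-nonNeg b {{nonNegative 0≤b}} c≤d ⟩
    b * d  ∎

  *-nonneg : ∀ {a b} → 0ℚ ≤ a → 0ℚ ≤ b → 0ℚ ≤ a * b
  *-nonneg {a} {b} 0≤a 0≤b = subst (_≤ a * b) (ℚ.*-zeroˡ 0ℚ)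
    (*-mono-≤ 0≤a ℚ.≤-refl 0≤a 0≤b)

  *-pos : ∀ {a b} → 0ℚ < a → 0ℚ < b → 0ℚ < a * b
  *-pos {a} {b} 0<a 0<b = ℚ.positive⁻¹ (a * b)
    {{ℚ.pos*pos⇒pos a {{positive 0<a}} b {{positive 0<b}}}}

  ½-pos : ∀ {ε} → 0ℚ < ε → 0ℚ < ½ * ε
  ½-pos = *-pos (ℚ.positive⁻¹ ½)

  ∣∣-sym : ∀ p q → ∣ p - q ∣ ≡ ∣ q - p ∣
  ∣∣-sym p q = begin-equality
    ∣ p - q ∣      ≡⟨ ℚ.∣-p∣≡∣p∣ (p - q) ⟨
    ∣ - (p - q) ∣  ≡⟨ cong ∣_∣ (solve 2 (λ p q → :- (p :- q) := q :- p) refl p q) ⟩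
    ∣ q - p ∣      ∎

  triangle : ∀ p q r → ∣ p - r ∣ ≤ ∣ p - q ∣ + ∣ q - r ∣
  triangle p q r = begin
    ∣ p - r ∣              ≡⟨ cong ∣_∣ (solve 3 (λ p q r →
                                p :- r := (p :- q) :+ (q :- r)) refl p q r) ⟩
    ∣ (p - q) + (q - r) ∣  ≤⟨ ℚ.∣p+q∣≤∣p∣+∣q∣ (p - q) (q - r) ⟩
    ∣ p - q ∣ + ∣ q - r ∣  ∎

  ∣∣-bound : ∀ p q → ∣ p ∣ ≤ ∣ q ∣ + ∣ p - q ∣
  ∣∣-bound p q = begin
    ∣ p ∣              ≡⟨ cong ∣_∣ (solve 2 (λ p q → p := q :+ (p :- q)) refl p q) ⟩
    ∣ q + (p - q) ∣    ≤⟨ ℚ.∣p+q∣≤∣p∣+∣q∣ q (p - q) ⟩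
    ∣ q ∣ + ∣ p - q ∣  ∎

  p-p≤ε : ∀ p {ε} → 0ℚ < ε → ∣ p - p ∣ ≤ ε
  p-p≤ε p 0<ε = subst (_≤ _) (cong ∣_∣ (sym (ℚ.+-inverseʳ p))) (ℚ.<⇒≤ 0<ε)

-- Totalised by recip 0ℚ = 0ℚ; only used at positive arguments.
recip : ℚ → ℚ
recip p with p ℚ.≟ 0ℚ
... | yes _  = 0ℚ
... | no p≢0 = (1/ p) {{≢-nonZero p≢0}}

*-recip : ∀ p → 0ℚ < p → p * recip p ≡ 1ℚ
*-recip p 0<p with p ℚ.≟ 0ℚ
... | yes p≡0 = ⊥-elim (ℚ.<-irrefl (sym p≡0) 0<p)
... | no p≢0  = ℚ.*-inverseʳ p {{≢-nonZero p≢0}}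

recip-pos : ∀ p → 0ℚ < p → 0ℚ < recip p
recip-pos p 0<p with p ℚ.≟ 0ℚ
... | yes p≡0 = ⊥-elim (ℚ.<-irrefl (sym p≡0) 0<p)
... | no p≢0  = ℚ.positive⁻¹ _ {{ℚ.1/pos⇒pos p {{positive 0<p}}}}

private
  recip-antitone : ∀ {c s} → 0ℚ < c → c ≤ s → recip s ≤ recip c
  recip-antitone {c} {s} 0<c c≤s = begin
    recip s                  ≡⟨ ℚ.*-identityˡ _ ⟨
    1ℚ * recip s             ≡⟨ cong (_* recip s) (*-recip c 0<c) ⟨
    c * recip c * recip s    ≤⟨ ℚ.*-monoʳ-≤-nonNeg _ {{nonNegative (ℚ.<⇒≤ 0<rs)}}
                                 (ℚ.*-monoʳ-≤-nonNeg _ {{nonNegative (ℚ.<⇒≤ 0<rc)}} c≤s) ⟩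
    s * recip c * recip s    ≡⟨ solve 3 (λ s a b → s :* a :* b := s :* b :* a)
                                 refl s (recip c) (recip s) ⟩
    s * recip s * recip c    ≡⟨ cong (_* recip c) (*-recip s 0<s) ⟩
    1ℚ * recip c             ≡⟨ ℚ.*-identityˡ _ ⟩
    recip c                  ∎
    where
    0<s = ℚ.<-≤-trans 0<c c≤s
    0<rs = recip-pos s 0<s
    0<rc = recip-pos c 0<c

  recip-lipschitz : ∀ {c s t} → 0ℚ < c → c ≤ s → c ≤ t →
                    ∣ recip s - recip t ∣ ≤ (recip c * recip c) * ∣ t - s ∣
  recip-lipschitz {c} {s} {t} 0<c c≤s c≤t = begin
    ∣ recip s - recip t ∣                ≡⟨ cong ∣_∣ eq ⟩
    ∣ (rs * rt) * (t - s) ∣              ≡⟨ ℚ.∣p*q∣≡∣p∣*∣q∣ (rs * rt) (t - s) ⟩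
    ∣ rs * rt ∣ * ∣ t - s ∣              ≡⟨ cong (_* ∣ t - s ∣) (ℚ.0≤p⇒∣p∣≡p (*-nonneg 0≤rs 0≤rt)) ⟩
    (rs * rt) * ∣ t - s ∣                ≤⟨ *-mono-≤ (*-nonneg 0≤rc 0≤rc) (ℚ.0≤∣p∣ (t - s))
                                             (*-mono-≤ 0≤rc 0≤rt (recip-antitone 0<c c≤s)
                                               (recip-antitone 0<c c≤t)) ℚ.≤-refl ⟩
    (recip c * recip c) * ∣ t - s ∣      ∎
    where
    rs = recip s
    rt = recip t
    0<s = ℚ.<-≤-trans 0<c c≤s
    0<t = ℚ.<-≤-trans 0<c c≤t
    0≤rs = ℚ.<⇒≤ (recip-pos s 0<s)
    0≤rt = ℚ.<⇒≤ (recip-pos t 0<t)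
    0≤rc = ℚ.<⇒≤ (recip-pos c 0<c)
    eq : rs - rt ≡ (rs * rt) * (t - s)
    eq = begin-equality
      rs - rt                          ≡⟨ solve 2 (λ a b → a :- b := con 1ℚ :* a :- con 1ℚ :* b) refl rs rt ⟩
      1ℚ * rs - 1ℚ * rt                ≡⟨ cong₂ (λ u v → u * rs - v * rt) (*-recip t 0<t) (*-recip s 0<s) ⟨
      (t * rt) * rs - (s * rs) * rt    ≡⟨ solve 4 (λ s t a b →
                                            (t :* b) :* a :- (s :* a) :* b := (a :* b) :* (t :- s))
                                            refl s t rs rt ⟩
      (rs * rt) * (t - s)              ∎

  fromℚᵘ-+ : ∀ p q → fromℚᵘ (p ℚᵘ.+ q) ≡ fromℚᵘ p + fromℚᵘ q
  fromℚᵘ-+ p q = ℚ.toℚᵘ-injective (ℚᵘ.≃-trans (ℚ.toℚᵘ-fromℚᵘ (p ℚᵘ.+ q))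
    (ℚᵘ.≃-sym (ℚᵘ.≃-trans (ℚ.toℚᵘ-homo-+ (fromℚᵘ p) (fromℚᵘ q))
      (ℚᵘ.+-cong (ℚ.toℚᵘ-fromℚᵘ p) (ℚ.toℚᵘ-fromℚᵘ q)))))

  fromℚᵘ-mono : ∀ {p q} → p ℚᵘ.≤ q → fromℚᵘ p ≤ fromℚᵘ q
  fromℚᵘ-mono {p} {q} p≤q = ℚ.toℚᵘ-cancel-≤
    (ℚᵘ.≤-respˡ-≃ (ℚᵘ.≃-sym (ℚ.toℚᵘ-fromℚᵘ p))
      (ℚᵘ.≤-respʳ-≃ (ℚᵘ.≃-sym (ℚ.toℚᵘ-fromℚᵘ q)) p≤q))

fromℕ-+ : ∀ m n → fromℕ (m ℕ.+ n) ≡ fromℕ m + fromℕ n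
fromℕ-+ m n = trans
  (ℚ.fromℚᵘ-cong {ℚᵘ.mkℚᵘ (+ (m ℕ.+ n)) 0} {ℚᵘ.mkℚᵘ (+ m) 0 ℚᵘ.+ ℚᵘ.mkℚᵘ (+ n) 0}
    (ℚᵘ.*≡* (cong (ℤ._* + 1)
      (sym (cong₂ ℤ._+_ (ℤ.*-identityʳ (+ m)) (ℤ.*-identityʳ (+ n)))))))
  (fromℚᵘ-+ (ℚᵘ.mkℚᵘ (+ m) 0) (ℚᵘ.mkℚᵘ (+ n) 0))

fromℕ-mono : ∀ {m n} → m ℕ.≤ n → fromℕ m ≤ fromℕ n
fromℕ-mono {m} {n} m≤n = fromℚᵘ-mono {ℚᵘ.mkℚᵘ (+ m) 0} {ℚᵘ.mkℚᵘ (+ n) 0}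
  (ℚᵘ.*≤* (ℤ.*-monoʳ-≤-nonNeg (+ 1) (ℤ.+≤+ m≤n)))

fromℕ-pos : ∀ n .{{_ : NonZero n}} → 0ℚ < fromℕ n
fromℕ-pos (suc n) = ℚ.<-≤-trans (ℚ.positive⁻¹ 1ℚ) (fromℕ-mono {1} {suc n} (ℕ.s≤s ℕ.z≤n))

archimedean : ∀ p → ∃ λ n → p ≤ fromℕ n
archimedean p@record{} = ℤ.∣ ↥ p ∣ , subst (_≤ fromℕ ℤ.∣ ↥ p ∣) (ℚ.fromℚᵘ-toℚᵘ p)
  (fromℚᵘ-mono {toℚᵘ p} {ℚᵘ.mkℚᵘ (+ ℤ.∣ ↥ p ∣) 0} (ℚᵘ.*≤* le))
  where
  le : ↥ p ℤ.* + 1 ℤ.≤ + ℤ.∣ ↥ p ∣ ℤ.* ↧ p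
  le rewrite ℤ.*-identityʳ (↥ p) | sym (ℤ.pos-* ℤ.∣ ↥ p ∣ (↧ₙ p)) =
    ℤ.≤-trans (i≤∣i∣ (↥ p)) (ℤ.+≤+ (ℕ.m≤m*n ℤ.∣ ↥ p ∣ (↧ₙ p)))
    where
    i≤∣i∣ : ∀ i → i ℤ.≤ + ℤ.∣ i ∣
    i≤∣i∣ (+ n)      = ℤ.≤-refl
    i≤∣i∣ (ℤ.-[1+ n ]) = ℤ.-≤+

-- Real numbers are Cauchy sequences of rationals, without a fixed modulus.
Cauchy : (ℕ → ℚ) → Set
Cauchy x = ∀ ε → 0ℚ < ε →
  ∃ λ N → ∀ m n → N ℕ.≤ m → N ℕ.≤ n → ∣ x m - x n ∣ ≤ ε

record ℝ : Set where
  constructor mkℝ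
  field
    seq    : ℕ → ℚ
    cauchy : Cauchy seq

open ℝ public

infix  4 _≤ℝ_
infixl 6 _+ℝ_
infixl 7 _*ℝ_

_≤ℝ_ : ℝ → ℝ → Set
x ≤ℝ y = ∀ ε → 0ℚ < ε → ∃ λ N → ∀ n → N ℕ.≤ n → seq x n ≤ seq y n + ε

fromℚ : ℚ → ℝ
fromℚ p = mkℝ (λ _ → p) (λ ε 0<ε → 0 , λ _ _ _ _ → p-p≤ε p 0<ε)

_+ℝ_ : ℝ → ℝ → ℝ
mkℝ x cx +ℝ mkℝ y cy = mkℝ (λ n → x n + y n) λ ε 0<ε →
  let (M , hx) = cx (½ * ε) (½-pos 0<ε)
      (N , hy) = cy (½ * ε) (½-pos 0<ε)
  in M ℕ.⊔ N , λ m n l₁ l₂ → begin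
    ∣ (x m + y m) - (x n + y n) ∣    ≡⟨ cong ∣_∣ (solve 4 (λ a b c d →
                                         (a :+ b) :- (c :+ d) := (a :- c) :+ (b :- d))
                                         refl (x m) (y m) (x n) (y n)) ⟩
    ∣ (x m - x n) + (y m - y n) ∣    ≤⟨ ℚ.∣p+q∣≤∣p∣+∣q∣ (x m - x n) (y m - y n) ⟩
    ∣ x m - x n ∣ + ∣ y m - y n ∣    ≤⟨ ℚ.+-mono-≤
                                         (hx m n (ℕ.m⊔n≤o⇒m≤o M N l₁) (ℕ.m⊔n≤o⇒m≤o M N l₂))
                                         (hy m n (ℕ.m⊔n≤o⇒n≤o M N l₁) (ℕ.m⊔n≤o⇒n≤o M N l₂)) ⟩
    ½ * ε + ½ * ε                    ≡⟨ half-sum ε ⟩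
    ε                                ∎

private
  eventuallyBounded : ∀ {x} → Cauchy x → ∃ λ B → 0ℚ < B ×
                      ∃ λ N → ∀ n → N ℕ.≤ n → ∣ x n ∣ ≤ B
  eventuallyBounded {x} cx =
    let (N , h) = cx 1ℚ (ℚ.positive⁻¹ 1ℚ)
    in ∣ x N ∣ + 1ℚ ,
       ℚ.+-mono-≤-< (ℚ.0≤∣p∣ (x N)) (ℚ.positive⁻¹ 1ℚ) ,
       N , λ n N≤n → ℚ.≤-trans (∣∣-bound (x n) (x N))
         (ℚ.+-monoʳ-≤ ∣ x N ∣ (h n N N≤n ℕ.≤-refl))

_*ℝ_ : ℝ → ℝ → ℝ
mkℝ x cx *ℝ mkℝ y cy = mkℝ (λ n → x n * y n) λ ε 0<ε →
  let (A , 0<A , L , hA) = eventuallyBounded {x} cx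
      (B , 0<B , K , hB) = eventuallyBounded {y} cy
      (M , hx) = cx (recip B * (½ * ε)) (*-pos (recip-pos B 0<B) (½-pos 0<ε))
      (N , hy) = cy (recip A * (½ * ε)) (*-pos (recip-pos A 0<A) (½-pos 0<ε))
      cancel : ∀ {D} → 0ℚ < D → D * (recip D * (½ * ε)) ≡ ½ * ε
      cancel {D} 0<D = trans (sym (ℚ.*-assoc D (recip D) (½ * ε)))
        (trans (cong (_* (½ * ε)) (*-recip D 0<D)) (ℚ.*-identityˡ (½ * ε)))
      left  : ∀ {k} → (L ℕ.⊔ K) ℕ.⊔ (M ℕ.⊔ N) ℕ.≤ k → L ℕ.⊔ K ℕ.≤ k
      left  = ℕ.m⊔n≤o⇒m≤o (L ℕ.⊔ K) (M ℕ.⊔ N)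
      right : ∀ {k} → (L ℕ.⊔ K) ℕ.⊔ (M ℕ.⊔ N) ℕ.≤ k → M ℕ.⊔ N ℕ.≤ k
      right = ℕ.m⊔n≤o⇒n≤o (L ℕ.⊔ K) (M ℕ.⊔ N)
  in (L ℕ.⊔ K) ℕ.⊔ (M ℕ.⊔ N) , λ m n l₁ l₂ → begin
    ∣ x m * y m - x n * y n ∣
      ≡⟨ cong ∣_∣ (solve 4 (λ a b c d → a :* b :- c :* d := a :* (b :- d) :+ d :* (a :- c))
           refl (x m) (y m) (x n) (y n)) ⟩
    ∣ x m * (y m - y n) + y n * (x m - x n) ∣
      ≤⟨ ℚ.∣p+q∣≤∣p∣+∣q∣ (x m * (y m - y n)) (y n * (x m - x n)) ⟩
    ∣ x m * (y m - y n) ∣ + ∣ y n * (x m - x n) ∣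
      ≡⟨ cong₂ _+_ (ℚ.∣p*q∣≡∣p∣*∣q∣ (x m) (y m - y n)) (ℚ.∣p*q∣≡∣p∣*∣q∣ (y n) (x m - x n)) ⟩
    ∣ x m ∣ * ∣ y m - y n ∣ + ∣ y n ∣ * ∣ x m - x n ∣
      ≤⟨ ℚ.+-mono-≤
           (*-mono-≤ (ℚ.<⇒≤ 0<A) (ℚ.0≤∣p∣ (y m - y n)) (hA m (ℕ.m⊔n≤o⇒m≤o L K (left l₁)))
             (hy m n (ℕ.m⊔n≤o⇒n≤o M N (right l₁)) (ℕ.m⊔n≤o⇒n≤o M N (right l₂))))
           (*-mono-≤ (ℚ.<⇒≤ 0<B) (ℚ.0≤∣p∣ (x m - x n)) (hB n (ℕ.m⊔n≤o⇒n≤o L K (left l₂)))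
             (hx m n (ℕ.m⊔n≤o⇒m≤o M N (right l₁)) (ℕ.m⊔n≤o⇒m≤o M N (right l₂)))) ⟩
    A * (recip A * (½ * ε)) + B * (recip B * (½ * ε))
      ≡⟨ cong₂ _+_ (cancel 0<A) (cancel 0<B) ⟩
    ½ * ε + ½ * ε
      ≡⟨ half-sum ε ⟩
    ε ∎

riemannSum : (ℚ → ℚ) → ℚ → ℚ → (N : ℕ) → .{{NonZero N}} → ℚ
riemannSum f a b N = ℚ-Sum.∑[ i < N ] (f (a + fromℕ (toℕ i) * h) * h)
  where h = (b - a) * (+ 1 / N)

-- log x = ∫₁ˣ dt/t, as the limit of left Riemann sums with 2^k equal steps
-- (for x < 1 the steps are negative).
logSeq : ℚ → ℕ → ℚ
logSeq x k = riemannSum recip 1ℚ x (2 ℕ.^ k) {{ℕ.m^n≢0 2 k}}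

private
  ∑-bound : ∀ N (u v : Fin N → ℚ) {B} → (∀ i → ∣ u i - v i ∣ ≤ B) →
            ∣ ℚ-Sum.sum u - ℚ-Sum.sum v ∣ ≤ fromℕ N * B
  ∑-bound zero    u v {B} h = ℚ.≤-reflexive (sym (ℚ.*-zeroˡ B))
  ∑-bound (suc N) u v {B} h = begin
    ∣ (u zero + U) - (v zero + V) ∣    ≡⟨ cong ∣_∣ (solve 4 (λ a b c d →
                                           (a :+ b) :- (c :+ d) := (a :- c) :+ (b :- d))
                                           refl (u zero) U (v zero) V) ⟩
    ∣ (u zero - v zero) + (U - V) ∣    ≤⟨ ℚ.∣p+q∣≤∣p∣+∣q∣ (u zero - v zero) (U - V) ⟩
    ∣ u zero - v zero ∣ + ∣ U - V ∣    ≤⟨ ℚ.+-mono-≤ (h zero) (∑-bound N (u ∘ suc) (v ∘ suc) (h ∘ suc)) ⟩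
    B + fromℕ N * B                    ≡⟨ solve 2 (λ b n → b :+ n :* b := (con 1ℚ :+ n) :* b)
                                           refl B (fromℕ N) ⟩
    (1ℚ + fromℕ N) * B                 ≡⟨ cong (_* B) (fromℕ-+ 1 N) ⟨
    fromℕ (suc N) * B                  ∎
    where
    U = ℚ-Sum.sum (u ∘ suc)
    V = ℚ-Sum.sum (v ∘ suc)

  ∑-double : ∀ N (g : ℕ → ℚ) → ℚ-Sum.∑[ i < 2 ℕ.* N ] g (toℕ i) ≡
             ℚ-Sum.∑[ i < N ] (g (2 ℕ.* toℕ i) + g (suc (2 ℕ.* toℕ i)))
  ∑-double zero    g = refl
  ∑-double (suc N) g = begin-equality
    ℚ-Sum.∑[ i < 2 ℕ.* suc N ] g (toℕ i)
      ≡⟨ cong (λ M → ℚ-Sum.∑[ i < M ] g (toℕ i)) (ℕ.*-suc 2 N) ⟩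
    g 0 + (g 1 + ℚ-Sum.∑[ i < 2 ℕ.* N ] g (2 ℕ.+ toℕ i))
      ≡⟨ ℚ.+-assoc (g 0) (g 1) _ ⟨
    (g 0 + g 1) + ℚ-Sum.∑[ i < 2 ℕ.* N ] g (2 ℕ.+ toℕ i)
      ≡⟨ cong (_+_ (g 0 + g 1)) (∑-double N (λ i → g (2 ℕ.+ i))) ⟩
    (g 0 + g 1) + ℚ-Sum.∑[ i < N ] (g (2 ℕ.+ 2 ℕ.* toℕ i) + g (3 ℕ.+ 2 ℕ.* toℕ i))
      ≡⟨ cong (_+_ (g 0 + g 1)) (ℚ-Sum.sum-cong-≗ {N} (λ i →
           cong (λ j → g j + g (suc j)) (ℕ.*-suc 2 (toℕ i)))) ⟨
    (g 0 + g 1) + ℚ-Sum.∑[ i < N ] (g (2 ℕ.* suc (toℕ i)) + g (suc (2 ℕ.* suc (toℕ i))))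
      ∎

  fromℕ-*-inverse : ∀ n .{{_ : NonZero n}} → fromℕ n * (+ 1 / n) ≡ 1ℚ
  fromℕ-*-inverse (suc n) = ℚ.toℚᵘ-injective (ℚᵘ.≃-trans
    (ℚ.toℚᵘ-homo-* (fromℕ (suc n)) (+ 1 / suc n))
    (ℚᵘ.≃-trans
      (ℚᵘ.*-cong (ℚ.toℚᵘ-fromℚᵘ (ℚᵘ.mkℚᵘ (+ suc n) 0)) (ℚ.toℚᵘ-fromℚᵘ (ℚᵘ.mkℚᵘ (+ 1) n)))
      (ℚᵘ.*≡* (cong (λ k → + suc k)
        (trans (cong (ℕ._* 1) (ℕ.*-identityʳ n)) (trans (ℕ.*-identityʳ n)
          (sym (trans (ℕ.+-identityʳ (n ℕ.+ 0)) (ℕ.+-identityʳ n)))))))))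

  0≤1/ : ∀ n .{{_ : NonZero n}} → 0ℚ ≤ + 1 / n
  0≤1/ n = ℚ.nonNegative⁻¹ (+ 1 / n) {{ℚ.normalize-nonNeg 1 n}}

  1/-double : ∀ n .{{_ : NonZero n}} .{{_ : NonZero (2 ℕ.* n)}} →
              + 1 / (2 ℕ.* n) ≡ ½ * (+ 1 / n)
  1/-double n = begin-equality
    i₂                         ≡⟨ ℚ.*-identityʳ i₂ ⟨
    i₂ * 1ℚ                    ≡⟨ cong (_*_ (i₂)) (fromℕ-*-inverse n) ⟨
    i₂ * (fromℕ n * i₁)        ≡⟨ solve 3 (λ a b c → a :* (b :* c) :=
                                   con ½ :* (((b :+ b) :* a) :* c)) refl i₂ (fromℕ n) i₁ ⟩
    ½ * (((fromℕ n + fromℕ n) * i₂) * i₁)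
                               ≡⟨ cong (λ z → ½ * ((z * i₂) * i₁)) double ⟨
    ½ * ((fromℕ (2 ℕ.* n) * i₂) * i₁)
                               ≡⟨ cong (λ z → ½ * (z * i₁)) (fromℕ-*-inverse (2 ℕ.* n)) ⟩
    ½ * (1ℚ * i₁)              ≡⟨ cong (_*_ (½)) (ℚ.*-identityˡ i₁) ⟩
    ½ * i₁                     ∎
    where
    i₁ = + 1 / n
    i₂ = + 1 / (2 ℕ.* n)
    double : fromℕ (2 ℕ.* n) ≡ fromℕ n + fromℕ n
    double = trans (cong (λ m → fromℕ (n ℕ.+ m)) (ℕ.+-identityʳ n)) (fromℕ-+ n n)

  module LogCauchy (x : ℚ) (0<x : 0ℚ < x) where

    w : ℕ → ℚ
    w k = (+ 1 / (2 ℕ.^ k)) {{ℕ.m^n≢0 2 k}}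

    0≤w : ∀ k → 0ℚ ≤ w k
    0≤w k = 0≤1/ (2 ℕ.^ k) {{ℕ.m^n≢0 2 k}}

    2^k*w≡1 : ∀ k → fromℕ (2 ℕ.^ k) * w k ≡ 1ℚ
    2^k*w≡1 k = fromℕ-*-inverse (2 ℕ.^ k) {{ℕ.m^n≢0 2 k}}

    h : ℕ → ℚ
    h k = (x - 1ℚ) * w k

    point : ℕ → ℕ → ℚ
    point k i = 1ℚ + fromℕ i * h k

    w-suc : ∀ k → w (suc k) ≡ ½ * w k
    w-suc k = 1/-double (2 ℕ.^ k) {{ℕ.m^n≢0 2 k}} {{ℕ.m^n≢0 2 (suc k)}}

    h-suc : ∀ k → h k ≡ h (suc k) + h (suc k)
    h-suc k = begin-equality
      (x - 1ℚ) * w k                    ≡⟨ solve 2 (λ a b → a :* b :=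
                                            a :* (con ½ :* b) :+ a :* (con ½ :* b)) refl (x - 1ℚ) (w k) ⟩
      (x - 1ℚ) * (½ * w k) + (x - 1ℚ) * (½ * w k)
                                        ≡⟨ cong (λ z → (x - 1ℚ) * z + (x - 1ℚ) * z) (w-suc k) ⟨
      h (suc k) + h (suc k)             ∎

    point-even : ∀ k i → point (suc k) (2 ℕ.* i) ≡ point k i
    point-even k i = cong (_+_ 1ℚ) (begin-equality
      fromℕ (2 ℕ.* i) * h (suc k)
        ≡⟨ cong (λ m → fromℕ (i ℕ.+ m) * h (suc k)) (ℕ.+-identityʳ i) ⟩
      fromℕ (i ℕ.+ i) * h (suc k)
        ≡⟨ cong (_* h (suc k)) (fromℕ-+ i i) ⟩
      (fromℕ i + fromℕ i) * h (suc k)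
        ≡⟨ solve 2 (λ a b → (a :+ a) :* b := a :* (b :+ b)) refl (fromℕ i) (h (suc k)) ⟩
      fromℕ i * (h (suc k) + h (suc k))
        ≡⟨ cong (_*_ (fromℕ i)) (h-suc k) ⟨
      fromℕ i * h k ∎)

    point-odd : ∀ k i → point (suc k) (suc (2 ℕ.* i)) ≡ point k i + h (suc k)
    point-odd k i = begin-equality
      1ℚ + fromℕ (suc (2 ℕ.* i)) * h (suc k)
        ≡⟨ cong (λ z → 1ℚ + z * h (suc k)) (fromℕ-+ 1 (2 ℕ.* i)) ⟩
      1ℚ + (1ℚ + fromℕ (2 ℕ.* i)) * h (suc k)
        ≡⟨ solve 2 (λ n a → con 1ℚ :+ (con 1ℚ :+ n) :* a := (con 1ℚ :+ n :* a) :+ a)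
             refl (fromℕ (2 ℕ.* i)) (h (suc k)) ⟩
      point (suc k) (2 ℕ.* i) + h (suc k)
        ≡⟨ cong (_+ h (suc k)) (point-even k i) ⟩
      point k i + h (suc k) ∎

    c : ℚ
    c = 1ℚ ⊓ x

    0<c : 0ℚ < c
    0<c with ℚ.⊓-sel 1ℚ x
    ... | inj₁ eq = subst (0ℚ <_) (sym eq) (ℚ.positive⁻¹ 1ℚ)
    ... | inj₂ eq = subst (0ℚ <_) (sym eq) 0<x

    c≤point : ∀ k i → i ℕ.≤ 2 ℕ.^ k → c ≤ point k i
    c≤point k i i≤ = begin
      c                                  ≡⟨ solve 2 (λ c s → c := (con 1ℚ :- s) :* c :+ s :* c) refl c s ⟩
      (1ℚ - s) * c + s * c               ≤⟨ ℚ.+-mono-≤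
                                             (ℚ.*-monoˡ-≤-nonNeg (1ℚ - s) {{nonNegative 0≤1-s}} (ℚ.p⊓q≤p 1ℚ x))
                                             (ℚ.*-monoˡ-≤-nonNeg s {{nonNegative 0≤s}} (ℚ.p⊓q≤q 1ℚ x)) ⟩
      (1ℚ - s) * 1ℚ + s * x              ≡⟨ solve 3 (λ i w x →
                                             (con 1ℚ :- i :* w) :* con 1ℚ :+ (i :* w) :* x :=
                                             con 1ℚ :+ i :* ((x :- con 1ℚ) :* w))
                                             refl (fromℕ i) (w k) x ⟩
      point k i                          ∎
      where
      s = fromℕ i * w k
      0≤s : 0ℚ ≤ s
      0≤s = *-nonneg (fromℕ-mono {0} {i} ℕ.z≤n) (0≤w k)
      s≤1 : s ≤ 1ℚ
      s≤1 = begin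
        fromℕ i * w k            ≤⟨ ℚ.*-monoʳ-≤-nonNeg (w k) {{nonNegative (0≤w k)}} (fromℕ-mono i≤) ⟩
        fromℕ (2 ℕ.^ k) * w k    ≡⟨ 2^k*w≡1 k ⟩
        1ℚ                       ∎
      0≤1-s : 0ℚ ≤ 1ℚ - s
      0≤1-s = subst (_≤ 1ℚ - s) (ℚ.+-inverseʳ s) (ℚ.+-monoˡ-≤ (- s) s≤1)

    L : ℚ
    L = recip c * recip c

    D : ℚ
    D = ½ * (L * (∣ x - 1ℚ ∣ * ∣ x - 1ℚ ∣))

    0≤D : 0ℚ ≤ D
    0≤D = *-nonneg (ℚ.nonNegative⁻¹ ½) (*-nonneg (*-nonneg 0≤rc 0≤rc)
      (*-nonneg (ℚ.0≤∣p∣ (x - 1ℚ)) (ℚ.0≤∣p∣ (x - 1ℚ))))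
      where 0≤rc = ℚ.<⇒≤ (recip-pos c 0<c)

    ∣h∣ : ∀ k → ∣ h k ∣ ≡ ∣ x - 1ℚ ∣ * w k
    ∣h∣ k = trans (ℚ.∣p*q∣≡∣p∣*∣q∣ (x - 1ℚ) (w k))
      (cong (_*_ (∣ x - 1ℚ ∣)) (ℚ.0≤p⇒∣p∣≡p (0≤w k)))

    step : ∀ k → ∣ logSeq x (suc k) - logSeq x k ∣ ≤ D * w (suc k)
    step k = begin
      ∣ logSeq x (suc k) - logSeq x k ∣
        ≡⟨ cong (λ z → ∣ z - logSeq x k ∣) (∑-double (2 ℕ.^ k) g) ⟩
      ∣ ℚ-Sum.sum u - ℚ-Sum.sum v ∣
        ≤⟨ ∑-bound (2 ℕ.^ k) u v bound ⟩
      fromℕ (2 ℕ.^ k) * ((L * ∣ h′ ∣) * ∣ h′ ∣)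
        ≡⟨ cong (λ z → fromℕ (2 ℕ.^ k) * ((L * z) * z))
             (trans (∣h∣ (suc k)) (cong (_*_ (∣ x - 1ℚ ∣)) (w-suc k))) ⟩
      fromℕ (2 ℕ.^ k) * ((L * (∣ x - 1ℚ ∣ * (½ * w k))) * (∣ x - 1ℚ ∣ * (½ * w k)))
        ≡⟨ solve 4 (λ n l a w → n :* ((l :* (a :* (con ½ :* w))) :* (a :* (con ½ :* w)))
             := (n :* w) :* ((con ½ :* (l :* (a :* a))) :* (con ½ :* w)))
             refl (fromℕ (2 ℕ.^ k)) L ∣ x - 1ℚ ∣ (w k) ⟩
      (fromℕ (2 ℕ.^ k) * w k) * (D * (½ * w k))
        ≡⟨ cong₂ (λ y z → y * (D * z)) (2^k*w≡1 k) (sym (w-suc k)) ⟩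
      1ℚ * (D * w (suc k))
        ≡⟨ ℚ.*-identityˡ _ ⟩
      D * w (suc k) ∎
      where
      h′ = h (suc k)
      g : ℕ → ℚ
      g i = recip (point (suc k) i) * h′
      u v : Fin (2 ℕ.^ k) → ℚ
      u i = g (2 ℕ.* toℕ i) + g (suc (2 ℕ.* toℕ i))
      v i = recip (point k (toℕ i)) * h k
      bound : ∀ i → ∣ u i - v i ∣ ≤ (L * ∣ h′ ∣) * ∣ h′ ∣
      bound i = begin
        ∣ u i - v i ∣
          ≡⟨ cong₂ (λ y z → ∣ (recip y * h′ + recip q * h′) - recip p * z ∣)
               (point-even k (toℕ i)) (h-suc k) ⟩
        ∣ (recip p * h′ + recip q * h′) - recip p * (h′ + h′) ∣
          ≡⟨ cong ∣_∣ (solve 3 (λ p q h → (p :* h :+ q :* h) :- p :* (h :+ h) := (q :- p) :* h)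
               refl (recip p) (recip q) h′) ⟩
        ∣ (recip q - recip p) * h′ ∣
          ≡⟨ ℚ.∣p*q∣≡∣p∣*∣q∣ (recip q - recip p) h′ ⟩
        ∣ recip q - recip p ∣ * ∣ h′ ∣
          ≤⟨ ℚ.*-monoʳ-≤-nonNeg ∣ h′ ∣ {{ℚ.∣-∣-nonNeg h′}}
               (recip-lipschitz 0<c (c≤point (suc k) _ odd≤) (c≤point k (toℕ i) (ℕ.<⇒≤ i<))) ⟩
        (L * ∣ p - q ∣) * ∣ h′ ∣
          ≡⟨ cong (λ z → (L * z) * ∣ h′ ∣) ∣p-q∣ ⟩
        (L * ∣ h′ ∣) * ∣ h′ ∣ ∎
        where
        p = point k (toℕ i)
        q = point (suc k) (suc (2 ℕ.* toℕ i))
        i< = Fin.toℕ<n i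
        odd≤ : suc (2 ℕ.* toℕ i) ℕ.≤ 2 ℕ.^ suc k
        odd≤ = ℕ.*-monoʳ-< 2 i<
        ∣p-q∣ : ∣ p - q ∣ ≡ ∣ h′ ∣
        ∣p-q∣ = trans (∣∣-sym p q) (cong ∣_∣ (trans (cong (_- p) (point-odd k (toℕ i)))
          (solve 2 (λ p h → (p :+ h) :- p := h) refl p h′)))

    telescope : ∀ k j → ∣ logSeq x (j ℕ.+ k) - logSeq x k ∣ ≤ D * (w k - w (j ℕ.+ k))
    telescope k zero = ℚ.≤-reflexive (trans
      (cong ∣_∣ (ℚ.+-inverseʳ (logSeq x k)))
      (sym (trans (cong (_*_ (D)) (ℚ.+-inverseʳ (w k))) (ℚ.*-zeroʳ D))))
    telescope k (suc j) = begin
      ∣ logSeq x (suc n) - logSeq x k ∣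
        ≤⟨ triangle (logSeq x (suc n)) (logSeq x n) (logSeq x k) ⟩
      ∣ logSeq x (suc n) - logSeq x n ∣ + ∣ logSeq x n - logSeq x k ∣
        ≤⟨ ℚ.+-mono-≤ (step n) (telescope k j) ⟩
      D * w (suc n) + D * (w k - w n)
        ≡⟨ cong (λ z → D * z + D * (w k - w n)) (w-suc n) ⟩
      D * (½ * w n) + D * (w k - w n)
        ≡⟨ solve 3 (λ d a b → d :* (con ½ :* a) :+ d :* (b :- a) := d :* (b :- con ½ :* a))
             refl D (w n) (w k) ⟩
      D * (w k - ½ * w n)
        ≡⟨ cong (λ z → D * (w k - z)) (w-suc n) ⟨
      D * (w k - w (suc n)) ∎
      where n = j ℕ.+ k

    tail-bound : ∀ {k n} → k ℕ.≤ n → ∣ logSeq x n - logSeq x k ∣ ≤ D * w k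
    tail-bound {k} {n} k≤n = begin
      ∣ logSeq x n - logSeq x k ∣
        ≡⟨ cong (λ m → ∣ logSeq x m - logSeq x k ∣) (ℕ.m∸n+n≡m k≤n) ⟨
      ∣ logSeq x (n ℕ.∸ k ℕ.+ k) - logSeq x k ∣
        ≤⟨ telescope k (n ℕ.∸ k) ⟩
      D * (w k - w (n ℕ.∸ k ℕ.+ k))
        ≤⟨ ℚ.*-monoˡ-≤-nonNeg D {{nonNegative 0≤D}} (ℚ.+-monoʳ-≤ (w k)
             (ℚ.neg-antimono-≤ (0≤w (n ℕ.∸ k ℕ.+ k)))) ⟩
      D * (w k - 0ℚ)
        ≡⟨ cong (_*_ (D)) (ℚ.+-identityʳ (w k)) ⟩
      D * w k ∎

    n≤2^n : ∀ n → n ℕ.≤ 2 ℕ.^ n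
    n≤2^n zero    = ℕ.z≤n
    n≤2^n (suc n) = ℕ.+-mono-≤ (ℕ.m^n>0 2 n)
      (ℕ.≤-trans (n≤2^n n) (ℕ.m≤m+n (2 ℕ.^ n) 0))

    small : ∀ {ε} → 0ℚ < ε → ∃ λ k → D * w k ≤ ε
    small {ε} 0<ε = let (k , le) = archimedean (D * recip ε) in k , (begin
      D * w k                              ≡⟨ ℚ.*-identityʳ _ ⟨
      D * w k * 1ℚ                         ≡⟨ cong (_*_ (D * w k)) (*-recip ε 0<ε) ⟨
      D * w k * (ε * recip ε)              ≡⟨ solve 4 (λ a b c d →
                                               a :* b :* (c :* d) := (a :* d) :* (b :* c))
                                               refl D (w k) ε (recip ε) ⟩
      (D * recip ε) * (w k * ε)            ≤⟨ ℚ.*-monoʳ-≤-nonNeg (w k * ε)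
                                               {{nonNegative (*-nonneg (0≤w k) (ℚ.<⇒≤ 0<ε))}}
                                               (ℚ.≤-trans le (fromℕ-mono (n≤2^n k))) ⟩
      fromℕ (2 ℕ.^ k) * (w k * ε)          ≡⟨ ℚ.*-assoc (fromℕ (2 ℕ.^ k)) (w k) ε ⟨
      fromℕ (2 ℕ.^ k) * w k * ε            ≡⟨ cong (_* ε) (2^k*w≡1 k) ⟩
      1ℚ * ε                               ≡⟨ ℚ.*-identityˡ ε ⟩
      ε                                    ∎)

    logCauchy : Cauchy (logSeq x)
    logCauchy ε 0<ε = let (k , le) = small (½-pos 0<ε) in k , λ m n k≤m k≤n → begin
      ∣ logSeq x m - logSeq x n ∣
        ≤⟨ triangle (logSeq x m) (logSeq x k) (logSeq x n) ⟩
      ∣ logSeq x m - logSeq x k ∣ + ∣ logSeq x k - logSeq x n ∣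
        ≡⟨ cong (_+_ (∣ logSeq x m - logSeq x k ∣)) (∣∣-sym (logSeq x k) (logSeq x n)) ⟩
      ∣ logSeq x m - logSeq x k ∣ + ∣ logSeq x n - logSeq x k ∣
        ≤⟨ ℚ.+-mono-≤ (ℚ.≤-trans (tail-bound k≤m) le) (ℚ.≤-trans (tail-bound k≤n) le) ⟩
      ½ * ε + ½ * ε
        ≡⟨ half-sum ε ⟩
      ε ∎

log : (x : ℚ) → .{{Positive x}} → ℝ
log x = mkℝ (logSeq x) (LogCauchy.logCauchy x (ℚ.positive⁻¹ x))

-- Give c the weight 1 / V_|c|, where V_j is the size of the upward balls at level j. This is
-- a fractional cover of total weight ν, so some ball contains at least a fraction x = 1/ν of
-- any given set of points. Greedily, after t steps that leave points uncovered and one final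
-- step, 1 ≤ 2ⁿ (1 - x)ᵗ; hence t x ≤ n log 2, and t + 1 ≤ (n log 2 + 1) ν as 1 ≤ ν.
-- To stay within ℚ, 2 is written as the product over i < N of 1 + 1 / (N + i), where N = 2ᵏ.
-- The terms 1 / (N + i) sum to the k-th Riemann sum for log 2, so AM-GM for the product
-- 2ⁿ (1 - x)ᵗ ≥ 1 bounds t x by n times that sum, for every k.

module Submission where

open import Algebra.Bundles using (CommutativeRing)
open import Data.Bool using (Bool; true; false; not; T)
import Data.Bool as Bool
open import Data.Empty using (⊥-elim)
open import Data.Fin using (Fin; zero; suc; toℕ)
import Data.Integer as ℤ
import Data.Integer.Properties as ℤ
open import Data.List using
  (List; []; _∷_; _++_; length; map; foldr; concat; replicate; filterᵇ; tabulate; deduplicate)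
import Data.List.Properties as List
open import Data.List.Relation.Unary.All using (All; []; _∷_)
import Data.List.Relation.Unary.All as All
import Data.List.Relation.Unary.All.Properties as All
open import Data.List.Relation.Unary.Any using (Any; here; there)
import Data.List.Relation.Unary.Any as Any
import Data.List.Relation.Unary.Any.Properties as Any
open import Data.Nat using (ℕ; zero; suc)
import Data.Nat as ℕ
open import Data.Nat.Combinatorics using (_C_; nCk+nC[k+1]≡[n+1]C[k+1]; k>n⇒nCk≡0)
open import Data.Nat.Induction using (<-wellFounded)
import Data.Nat.Properties as ℕ
open import Data.Product using (∃; _×_; _,_; proj₂)
open import Data.Rational using (ℚ; 0ℚ; 1ℚ; _+_; _*_; _-_; -_; _/_; _≤_; _<_; nonNegative; positive)
import Data.Rational.Properties as ℚ
import Data.Rational.Unnormalised as ℚᵘ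
import Data.Rational.Unnormalised.Properties as ℚᵘ
open import Data.Rational.Solver using (module +-*-Solver)
open import Data.Sum using ([_,_]′)
open import Data.Vec using ([]; _∷_; count)
import Data.Vec as Vec
import Data.Vec.Properties as Vec
open import Defs using (K⁺; ν; fromℕ; fromℚ; log; _≤ℝ_; _+ℝ_; _*ℝ_;
  Q; B⁻; DownwardCovers; cube; ∈-cube; minimumCover; upBallSize;
  fromℕ-+; fromℕ-mono; fromℕ-pos; recip; *-recip; recip-pos; logSeq)
open import Function using (_∘_)
open import Induction.WellFounded using (Acc; acc)
open import Relation.Binary.PropositionalEquality
open import Relation.Nullary using (yes; no)

open import Data.List.Extrema ℕ.≤-totalOrder using (argmax; f[xs]≤f[argmax])
import Algebra.Properties.Semiring.Sum ℕ.+-*-semiring as ℕ-Sum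
import Algebra.Properties.Semiring.Sum
  (CommutativeRing.semiring ℚ.+-*-commutativeRing) as ℚ-Sum
open import Algebra.Properties.Semiring.Exp
  (CommutativeRing.semiring ℚ.+-*-commutativeRing) using (_^_)
open import Data.List.Relation.Unary.Unique.DecPropositional.Properties using (deduplicate-!)

open +-*-Solver using (solve; _:+_; _:*_; _:-_; _:=_; con)
open ℚ.≤-Reasoning

-- Ordered-field facts about the rationals.

*-nonNeg : ∀ {p q} → 0ℚ ≤ p → 0ℚ ≤ q → 0ℚ ≤ p * q
*-nonNeg {p} {q} 0≤p 0≤q = ℚ.nonNegative⁻¹ (p * q)
  {{ℚ.nonNeg*nonNeg⇒nonNeg p {{nonNegative 0≤p}} q {{nonNegative 0≤q}}}}

*-monoˡ-≤ : ∀ {r p q} → 0ℚ ≤ r → p ≤ q → r * p ≤ r * q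
*-monoˡ-≤ {r} 0≤r = ℚ.*-monoˡ-≤-nonNeg r {{nonNegative 0≤r}}

*-monoʳ-≤ : ∀ {r p q} → 0ℚ ≤ r → p ≤ q → p * r ≤ q * r
*-monoʳ-≤ {r} 0≤r = ℚ.*-monoʳ-≤-nonNeg r {{nonNegative 0≤r}}

p≤q⇒0≤q-p : ∀ {p q} → p ≤ q → 0ℚ ≤ q - p
p≤q⇒0≤q-p {p} {q} p≤q = subst (_≤ q - p) (ℚ.+-inverseʳ p) (ℚ.+-monoˡ-≤ (- p) p≤q)

p-q≤p : ∀ p {q} → 0ℚ ≤ q → p - q ≤ p
p-q≤p p {q} 0≤q = subst (p - q ≤_) (ℚ.+-identityʳ p) (ℚ.+-monoʳ-≤ p (ℚ.neg-antimono-≤ 0≤q))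

0≤1 : 0ℚ ≤ 1ℚ
0≤1 = ℚ.nonNegative⁻¹ 1ℚ

0<1 : 0ℚ < 1ℚ
0<1 = ℚ.positive⁻¹ 1ℚ

fromℕ-nonNeg : ∀ n → 0ℚ ≤ fromℕ n
fromℕ-nonNeg n = fromℕ-mono {0} {n} ℕ.z≤n

fromℕ-cancel-< : ∀ {m n} → fromℕ m < fromℕ n → m ℕ.< n
fromℕ-cancel-< m<n = ℕ.≰⇒> λ n≤m → ℚ.<-irrefl refl (ℚ.<-≤-trans m<n (fromℕ-mono n≤m))

fromℕ-*-/ : ∀ a n .{{_ : ℕ.NonZero n}} → fromℕ n * (ℤ.+ a / n) ≡ fromℕ a
fromℕ-*-/ a (suc n) = ℚ.toℚᵘ-injective (ℚᵘ.≃-trans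
  (ℚ.toℚᵘ-homo-* (fromℕ (suc n)) (ℤ.+ a / suc n))
  (ℚᵘ.≃-trans
    (ℚᵘ.*-cong (ℚ.toℚᵘ-fromℚᵘ (ℚᵘ.mkℚᵘ (ℤ.+ suc n) 0)) (ℚ.toℚᵘ-fromℚᵘ (ℚᵘ.mkℚᵘ (ℤ.+ a) n)))
    (ℚᵘ.≃-trans (ℚᵘ.*≡* eq) (ℚᵘ.≃-sym (ℚ.toℚᵘ-fromℚᵘ (ℚᵘ.mkℚᵘ (ℤ.+ a) 0))))))
  where
  eq : (ℤ.+ suc n ℤ.* ℤ.+ a) ℤ.* ℤ.+ 1 ≡ ℤ.+ a ℤ.* ℤ.+ (1 ℕ.* suc n)
  eq = trans (ℤ.*-identityʳ _) (trans (ℤ.*-comm (ℤ.+ suc n) (ℤ.+ a))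
    (cong (λ k → ℤ.+ a ℤ.* ℤ.+ k) (sym (ℕ.*-identityˡ (suc n)))))

1≤p⇒0<p : ∀ {p} → 1ℚ ≤ p → 0ℚ < p
1≤p⇒0<p = ℚ.<-≤-trans 0<1

recip-≤1 : ∀ {p} → 1ℚ ≤ p → recip p ≤ 1ℚ
recip-≤1 {p} 1≤p = begin
  recip p         ≡⟨ ℚ.*-identityˡ _ ⟨
  1ℚ * recip p    ≤⟨ *-monoʳ-≤ (ℚ.<⇒≤ (recip-pos p 0<p)) 1≤p ⟩
  p * recip p     ≡⟨ *-recip p 0<p ⟩
  1ℚ              ∎
  where 0<p = 1≤p⇒0<p 1≤p

recip-antitone : ∀ {p q} → 0ℚ < p → p ≤ q → recip q ≤ recip p
recip-antitone {p} {q} 0<p p≤q = begin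
  recip q                  ≡⟨ ℚ.*-identityˡ _ ⟨
  1ℚ * recip q             ≡⟨ cong (_* recip q) (*-recip p 0<p) ⟨
  p * recip p * recip q    ≡⟨ ℚ.*-assoc p (recip p) (recip q) ⟩
  p * (recip p * recip q)  ≤⟨ *-monoʳ-≤ (*-nonNeg (ℚ.<⇒≤ (recip-pos p 0<p)) (ℚ.<⇒≤ (recip-pos q 0<q))) p≤q ⟩
  q * (recip p * recip q)  ≡⟨ solve 3 (λ q a b → q :* (a :* b) := q :* b :* a) refl q (recip p) (recip q) ⟩
  q * recip q * recip p    ≡⟨ cong (_* recip p) (*-recip q 0<q) ⟩
  1ℚ * recip p             ≡⟨ ℚ.*-identityˡ _ ⟩
  recip p                  ∎
  where 0<q = ℚ.<-≤-trans 0<p p≤q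

-- Sums and products over lists

sum : List ℚ → ℚ
sum = foldr _+_ 0ℚ

-- Factors are recorded by their excess over 1, so that one list serves as both the product and the
-- sum compared by AM-GM.
growth : List ℚ → ℚ
growth = foldr (λ a p → (1ℚ + a) * p) 1ℚ

sum-++ : ∀ as bs → sum (as ++ bs) ≡ sum as + sum bs
sum-++ []       bs = sym (ℚ.+-identityˡ (sum bs))
sum-++ (a ∷ as) bs = trans (cong (a +_) (sum-++ as bs)) (sym (ℚ.+-assoc a (sum as) (sum bs)))

growth-++ : ∀ as bs → growth (as ++ bs) ≡ growth as * growth bs
growth-++ []       bs = sym (ℚ.*-identityˡ (growth bs))
growth-++ (a ∷ as) bs = trans (cong ((1ℚ + a) *_) (growth-++ as bs))
  (sym (ℚ.*-assoc (1ℚ + a) (growth as) (growth bs)))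

sum-nonNeg : ∀ {as} → All (0ℚ ≤_) as → 0ℚ ≤ sum as
sum-nonNeg []            = ℚ.≤-refl
sum-nonNeg (0≤a ∷ 0≤as) = ℚ.+-mono-≤ 0≤a (sum-nonNeg 0≤as)

sum-tabulate : ∀ {n} (f : Fin n → ℚ) → sum (tabulate f) ≡ ℚ-Sum.sum f
sum-tabulate {zero}  f = refl
sum-tabulate {suc n} f = cong (f zero +_) (sum-tabulate (f ∘ suc))

module _ {A : Set} where

  sum-map-+ : ∀ (f g : A → ℚ) xs →
              sum (map (λ x → f x + g x) xs) ≡ sum (map f xs) + sum (map g xs)
  sum-map-+ f g []       = refl
  sum-map-+ f g (x ∷ xs) = trans (cong ((f x + g x) +_) (sum-map-+ f g xs))
    (solve 4 (λ a b c d → (a :+ b) :+ (c :+ d) := (a :+ c) :+ (b :+ d)) refl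
      (f x) (g x) (sum (map f xs)) (sum (map g xs)))

  sum-map-* : ∀ (f : A → ℚ) r xs → sum (map (λ x → f x * r) xs) ≡ sum (map f xs) * r
  sum-map-* f r []       = sym (ℚ.*-zeroˡ r)
  sum-map-* f r (x ∷ xs) = trans (cong (f x * r +_) (sum-map-* f r xs))
    (sym (ℚ.*-distribʳ-+ r (f x) (sum (map f xs))))

  sum-map-mono : ∀ {f g : A → ℚ} {xs} → All (λ x → f x ≤ g x) xs → sum (map f xs) ≤ sum (map g xs)
  sum-map-mono []            = ℚ.≤-refl
  sum-map-mono (f≤g ∷ fs≤gs) = ℚ.+-mono-≤ f≤g (sum-map-mono fs≤gs)

-- Comparing sums with products

module _ {x : ℚ} (0≤x : 0ℚ ≤ x) (x≤1 : x ≤ 1ℚ) where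

  private
    0≤1-x : 0ℚ ≤ 1ℚ - x
    0≤1-x = p≤q⇒0≤q-p x≤1

  decay-nonNeg : ∀ m → 0ℚ ≤ (1ℚ - x) ^ m
  decay-nonNeg zero    = 0≤1
  decay-nonNeg (suc m) = *-nonNeg 0≤1-x (decay-nonNeg m)

  decay≤1 : ∀ m → (1ℚ - x) ^ m ≤ 1ℚ
  decay≤1 zero    = ℚ.≤-refl
  decay≤1 (suc m) = begin
    (1ℚ - x) * (1ℚ - x) ^ m  ≤⟨ *-monoˡ-≤ 0≤1-x (decay≤1 m) ⟩
    (1ℚ - x) * 1ℚ            ≡⟨ ℚ.*-identityʳ _ ⟩
    1ℚ - x                   ≤⟨ p-q≤p 1ℚ 0≤x ⟩
    1ℚ                       ∎

  fromℕ-suc-* : ∀ m → fromℕ (suc m) * x ≡ x + fromℕ m * x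
  fromℕ-suc-* m = trans (cong (_* x) (fromℕ-+ 1 m))
    (solve 2 (λ m x → (con 1ℚ :+ m) :* x := x :+ m :* x) refl (fromℕ m) x)

  -- This is AM-GM for factors of product ≥ 1: merging 1 + v with a factor on the other
  -- side of 1 keeps the product and does not increase the sum of the excesses over 1.
  merge-factors : ∀ v as m → 0ℚ ≤ 1ℚ + v → All (0ℚ ≤_) as →
                  1ℚ ≤ (1ℚ + v) * (growth as * (1ℚ - x) ^ m) → fromℕ m * x ≤ v + sum as
  merge-factors v as m 0≤1+v 0≤as 1≤ with 0ℚ ℚ.≤? v
  merge-factors v as zero 0≤1+v 0≤as 1≤ | yes 0≤v = begin
    0ℚ * x      ≡⟨ ℚ.*-zeroˡ x ⟩
    0ℚ + 0ℚ     ≤⟨ ℚ.+-mono-≤ 0≤v (sum-nonNeg 0≤as) ⟩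
    v + sum as  ∎
  merge-factors v as (suc m) 0≤1+v 0≤as 1≤ | yes 0≤v = begin
    fromℕ (suc m) * x         ≡⟨ fromℕ-suc-* m ⟩
    x + fromℕ m * x           ≤⟨ ℚ.+-monoʳ-≤ x (merge-factors v′ as m
                                   (subst (0ℚ ≤_) merged (*-nonNeg 0≤1+v 0≤1-x)) 0≤as
                                   (subst (1ℚ ≤_) eq 1≤)) ⟩
    x + (v′ + sum as)         ≡⟨ solve 3 (λ v x s → x :+ ((v :- x :- v :* x) :+ s) :=
                                   (v :+ s) :- v :* x) refl v x (sum as) ⟩
    (v + sum as) - v * x      ≤⟨ p-q≤p (v + sum as) (*-nonNeg 0≤v 0≤x) ⟩
    v + sum as                ∎
    where
    v′ = v - x - v * x
    merged : (1ℚ + v) * (1ℚ - x) ≡ 1ℚ + v′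
    merged = solve 2 (λ v x → (con 1ℚ :+ v) :* (con 1ℚ :- x) :=
      con 1ℚ :+ (v :- x :- v :* x)) refl v x
    eq : (1ℚ + v) * (growth as * ((1ℚ - x) * (1ℚ - x) ^ m)) ≡
         (1ℚ + v′) * (growth as * (1ℚ - x) ^ m)
    eq = trans (solve 4 (λ a g b p → a :* (g :* (b :* p)) := (a :* b) :* (g :* p)) refl
        (1ℚ + v) (growth as) (1ℚ - x) ((1ℚ - x) ^ m))
      (cong (_* (growth as * (1ℚ - x) ^ m)) merged)
  -- Only powers of `1ℚ - x` are left beside 1 + v < 1, so the product cannot reach 1. The invariant
  -- 0 ≤ 1 + v is what allows (1 - x)ᵐ to be bounded by 1 under the factor 1 + v.
  merge-factors v [] m 0≤1+v 0≤as 1≤ | no 0≰v = ⊥-elim (ℚ.<-irrefl refl (begin-strict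
    1ℚ                                 ≤⟨ 1≤ ⟩
    (1ℚ + v) * (1ℚ * (1ℚ - x) ^ m)     ≡⟨ cong ((1ℚ + v) *_) (ℚ.*-identityˡ _) ⟩
    (1ℚ + v) * (1ℚ - x) ^ m            ≤⟨ *-monoˡ-≤ 0≤1+v (decay≤1 m) ⟩
    (1ℚ + v) * 1ℚ                      ≡⟨ ℚ.*-identityʳ _ ⟩
    1ℚ + v                             <⟨ ℚ.+-monoʳ-< 1ℚ (ℚ.≰⇒> 0≰v) ⟩
    1ℚ                                 ∎))
  merge-factors v (a ∷ as) m 0≤1+v (0≤a ∷ 0≤as) 1≤ | no 0≰v = begin
    fromℕ m * x                        ≤⟨ merge-factors v′ as m
                                            (subst (0ℚ ≤_) merged (*-nonNeg 0≤1+v 0≤1+a)) 0≤as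
                                            (subst (1ℚ ≤_) eq 1≤) ⟩
    v′ + sum as                        ≡⟨ solve 3 (λ v a s → (v :+ a :+ v :* a) :+ s :=
                                            (v :+ (a :+ s)) :+ v :* a) refl v a (sum as) ⟩
    (v + (a + sum as)) + v * a         ≤⟨ ℚ.+-monoʳ-≤ (v + (a + sum as)) va≤0 ⟩
    (v + (a + sum as)) + 0ℚ            ≡⟨ ℚ.+-identityʳ _ ⟩
    v + (a + sum as)                   ∎
    where
    v′ = v + a + v * a
    0≤1+a : 0ℚ ≤ 1ℚ + a
    0≤1+a = ℚ.+-mono-≤ 0≤1 0≤a
    va≤0 : v * a ≤ 0ℚ
    va≤0 = subst (v * a ≤_) (ℚ.*-zeroˡ a) (*-monoʳ-≤ 0≤a (ℚ.<⇒≤ (ℚ.≰⇒> 0≰v)))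
    merged : (1ℚ + v) * (1ℚ + a) ≡ 1ℚ + v′
    merged = solve 2 (λ v a → (con 1ℚ :+ v) :* (con 1ℚ :+ a) :=
      con 1ℚ :+ (v :+ a :+ v :* a)) refl v a
    eq : (1ℚ + v) * (((1ℚ + a) * growth as) * (1ℚ - x) ^ m) ≡
         (1ℚ + v′) * (growth as * (1ℚ - x) ^ m)
    eq = trans (solve 4 (λ a g b p → a :* ((b :* g) :* p) := (a :* b) :* (g :* p)) refl
        (1ℚ + v) (growth as) (1ℚ + a) ((1ℚ - x) ^ m))
      (cong (_* (growth as * (1ℚ - x) ^ m)) merged)

  -- Stands in for taking logarithms with log (1 + a) ≤ a and log (1 - x) ≤ -x. The merging starts
  -- from the neutral factor 1 + 0.
  growth-decay : ∀ as m → All (0ℚ ≤_) as → 1ℚ ≤ growth as * (1ℚ - x) ^ m → fromℕ m * x ≤ sum as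
  growth-decay as m 0≤as 1≤ = subst (fromℕ m * x ≤_) (ℚ.+-identityˡ (sum as))
    (merge-factors 0ℚ as m 0≤1 0≤as
      (subst (1ℚ ≤_) (sym (ℚ.*-identityˡ (growth as * (1ℚ - x) ^ m))) 1≤))

-- Each factor 1 + e i / g i equals g (i + 1) / g i. The factor `g 0` on the left avoids a division.
growth-telescope : ∀ (g e : ℕ → ℚ) → (∀ i → 0ℚ < g i) → (∀ i → g (suc i) ≡ g i + e i) →
                   ∀ N → growth (tabulate {n = N} (λ i → recip (g (toℕ i)) * e (toℕ i))) * g 0 ≡ g N
growth-telescope g e 0<g g-suc zero    = ℚ.*-identityˡ (g 0)
growth-telescope g e 0<g g-suc (suc N) = begin-equality
  ((1ℚ + recip (g 0) * e 0) * G) * g 0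
    ≡⟨ solve 4 (λ r e G g → ((con 1ℚ :+ r :* e) :* G) :* g := G :* (g :+ (g :* r) :* e))
         refl (recip (g 0)) (e 0) G (g 0) ⟩
  G * (g 0 + (g 0 * recip (g 0)) * e 0)
    ≡⟨ cong (λ z → G * (g 0 + z * e 0)) (*-recip (g 0) (0<g 0)) ⟩
  G * (g 0 + 1ℚ * e 0)
    ≡⟨ cong (λ z → G * (g 0 + z)) (ℚ.*-identityˡ (e 0)) ⟩
  G * (g 0 + e 0)
    ≡⟨ cong (G *_) (g-suc 0) ⟨
  G * g 1
    ≡⟨ growth-telescope (g ∘ suc) (e ∘ suc) (0<g ∘ suc) (g-suc ∘ suc) N ⟩
  g (suc N) ∎
  where
  G = growth (tabulate {n = N} (λ i → recip (g (suc (toℕ i))) * e (suc (toℕ i))))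

sum-copies : ∀ n as → sum (concat (replicate n as)) ≡ fromℕ n * sum as
sum-copies zero    as = sym (ℚ.*-zeroˡ (sum as))
sum-copies (suc n) as = begin-equality
  sum (as ++ concat (replicate n as))       ≡⟨ sum-++ as _ ⟩
  sum as + sum (concat (replicate n as))    ≡⟨ cong (sum as +_) (sum-copies n as) ⟩
  sum as + fromℕ n * sum as                   ≡⟨ solve 2 (λ n s → s :+ n :* s := (con 1ℚ :+ n) :* s)
                                                   refl (fromℕ n) (sum as) ⟩
  (1ℚ + fromℕ n) * sum as                     ≡⟨ cong (_* sum as) (fromℕ-+ 1 n) ⟨
  fromℕ (suc n) * sum as                      ∎

-- The Riemann sums for log 2 and the matching factorisation of 2.

module LogTwo (k : ℕ) where

  N : ℕ
  N = 2 ℕ.^ k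

  instance
    N-nonZero : ℕ.NonZero N
    N-nonZero = ℕ.m^n≢0 2 k

  -- This is 1 / N, spelled as the step width in `riemannSum` so that `sum-increments` needs no
  -- rewriting of the summands.
  h : ℚ
  h = (fromℕ 2 - 1ℚ) * (ℤ.+ 1 / N)

  N*h≡1 : fromℕ N * h ≡ 1ℚ
  N*h≡1 = trans (cong (fromℕ N *_) (ℚ.*-identityˡ (ℤ.+ 1 / N))) (fromℕ-*-/ 1 N)

  0≤h : 0ℚ ≤ h
  0≤h = subst (0ℚ ≤_) (sym (ℚ.*-identityˡ (ℤ.+ 1 / N)))
    (ℚ.nonNegative⁻¹ (ℤ.+ 1 / N) {{ℚ.normalize-nonNeg 1 N}})

  point : ℕ → ℚ
  point i = 1ℚ + fromℕ i * h

  0<point : ∀ i → 0ℚ < point i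
  0<point i = ℚ.+-mono-<-≤ 0<1 (*-nonNeg (fromℕ-nonNeg i) 0≤h)

  point-suc : ∀ i → point (suc i) ≡ point i + h
  point-suc i = trans (cong (λ z → 1ℚ + z * h) (fromℕ-+ 1 i))
    (solve 2 (λ i h → con 1ℚ :+ (con 1ℚ :+ i) :* h := (con 1ℚ :+ i :* h) :+ h) refl (fromℕ i) h)

  -- The i-th entry is (1 / N) / (1 + i / N) = 1 / (N + i).
  increments : List ℚ
  increments = tabulate {n = N} (λ i → recip (point (toℕ i)) * h)

  increments-nonNeg : All (0ℚ ≤_) increments
  increments-nonNeg = All.tabulate⁺ λ i →
    *-nonNeg (ℚ.<⇒≤ (recip-pos (point (toℕ i)) (0<point (toℕ i)))) 0≤h

  sum-increments : sum increments ≡ logSeq (fromℕ 2) k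
  sum-increments = sum-tabulate {N} (λ i → recip (point (toℕ i)) * h)

  -- The product telescopes along the subdivision points of [1, 2], from `point 0` = 1 to `point N`
  -- = 2.
  growth-increments : growth increments ≡ 1ℚ + 1ℚ
  growth-increments = begin-equality
    growth increments              ≡⟨ ℚ.*-identityʳ (growth increments) ⟨
    growth increments * 1ℚ         ≡⟨ cong (growth increments *_) point-0 ⟨
    growth increments * point 0    ≡⟨ growth-telescope point (λ _ → h) 0<point point-suc N ⟩
    1ℚ + fromℕ N * h               ≡⟨ cong (1ℚ +_) N*h≡1 ⟩
    1ℚ + 1ℚ                        ∎
    where
    point-0 : point 0 ≡ 1ℚ
    point-0 = trans (cong (1ℚ +_) (ℚ.*-zeroˡ h)) (ℚ.+-identityʳ 1ℚ)

-- Covering by the greedy algorithm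

𝟙 : Bool → ℚ
𝟙 true  = 1ℚ
𝟙 false = 0ℚ

𝟙≤1 : ∀ b → 𝟙 b ≤ 1ℚ
𝟙≤1 true  = ℚ.≤-refl
𝟙≤1 false = 0≤1

module _ {A B : Set} (covers : A → B → Bool) where

  covered : A → List B → ℕ
  covered a ys = length (filterᵇ (covers a) ys)

  uncovered : A → List B → List B
  uncovered a = filterᵇ (not ∘ covers a)

  Covers : List A → B → Set
  Covers 𝒞 y = Any (λ a → T (covers a y)) 𝒞

  covered+uncovered : ∀ a ys → covered a ys ℕ.+ length (uncovered a ys) ≡ length ys
  covered+uncovered a []       = refl
  covered+uncovered a (y ∷ ys) with covers a y
  ... | true  = cong suc (covered+uncovered a ys)
  ... | false = trans (ℕ.+-suc _ _) (cong suc (covered+uncovered a ys))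

  covers-∷ : ∀ a {𝒞} ys → All (Covers 𝒞) (uncovered a ys) → All (Covers (a ∷ 𝒞)) ys
  covers-∷ a []       []  = []
  covers-∷ a (y ∷ ys) cov with covers a y in eq
  covers-∷ a (y ∷ ys) cov       | true  = here (subst T (sym eq) _) ∷ covers-∷ a ys cov
  covers-∷ a (y ∷ ys) (c ∷ cov) | false = there c ∷ covers-∷ a ys cov

  module Greedy {x : ℚ} (0<x : 0ℚ < x) (x≤1 : x ≤ 1ℚ)
    (pick : ∀ ys → ∃ λ a → fromℕ (length ys) * x ≤ fromℕ (covered a ys)) where

    uncovered-≤ : ∀ {a ys} → fromℕ (length ys) * x ≤ fromℕ (covered a ys) →
                  fromℕ (length (uncovered a ys)) ≤ fromℕ (length ys) * (1ℚ - x)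
    uncovered-≤ {a} {ys} le = begin
      u                        ≡⟨ solve 2 (λ c u → u := (c :+ u) :- c) refl c u ⟩
      (c + u) - c              ≡⟨ cong (_- c) (fromℕ-+ (covered a ys) (length (uncovered a ys))) ⟨
      fromℕ (covered a ys ℕ.+ length (uncovered a ys)) - c
                               ≡⟨ cong (λ l → fromℕ l - c) (covered+uncovered a ys) ⟩
      l - c                    ≤⟨ ℚ.+-monoʳ-≤ l (ℚ.neg-antimono-≤ le) ⟩
      l - l * x                ≡⟨ solve 2 (λ l x → l :- l :* x := l :* (con 1ℚ :- x)) refl l x ⟩
      l * (1ℚ - x)             ∎
      where
      l = fromℕ (length ys)
      c = fromℕ (covered a ys)
      u = fromℕ (length (uncovered a ys))

    -- A positive fraction of a nonempty list is positive, so the pick covers at least one point.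
    -- This makes the greedy recursion well-founded.
    uncovered-< : ∀ {a ys} → 0 ℕ.< length ys → fromℕ (length ys) * x ≤ fromℕ (covered a ys) →
                  length (uncovered a ys) ℕ.< length ys
    uncovered-< {a} {ys} 0<l le = subst (length (uncovered a ys) ℕ.<_)
      (covered+uncovered a ys) (ℕ.m<n+m _ (fromℕ-cancel-< {0} (ℚ.<-≤-trans 0<lx le)))
      where
      0<lx : 0ℚ < fromℕ (length ys) * x
      0<lx = ℚ.positive⁻¹ _ {{ℚ.pos*pos⇒pos (fromℕ (length ys))
        {{positive (fromℕ-pos (length ys) {{ℕ.>-nonZero 0<l}})}} x {{positive 0<x}}}}

    decay-step : ∀ {a ys} t → fromℕ (length ys) * x ≤ fromℕ (covered a ys) →
                 1ℚ ≤ fromℕ (length (uncovered a ys)) * (1ℚ - x) ^ t →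
                 1ℚ ≤ fromℕ (length ys) * (1ℚ - x) ^ suc t
    decay-step {a} {ys} t le 1≤ = begin
      1ℚ                                       ≤⟨ 1≤ ⟩
      fromℕ (length (uncovered a ys)) * p      ≤⟨ *-monoʳ-≤ (decay-nonNeg (ℚ.<⇒≤ 0<x) x≤1 t)
                                                    (uncovered-≤ {a} {ys} le) ⟩
      (l * (1ℚ - x)) * p                       ≡⟨ ℚ.*-assoc l (1ℚ - x) p ⟩
      l * ((1ℚ - x) * p)                       ∎
      where
      l = fromℕ (length ys)
      p = (1ℚ - x) ^ t

    -- The estimate is taken before the last of the t + 1 picks: the first t picks leave at least
    -- one point uncovered, whereas after the last pick none remain.
    GreedyCover : List B → Set
    GreedyCover ys = ∃ λ 𝒞 → ∃ λ t →
      length 𝒞 ≡ suc t × All (Covers 𝒞) ys × 1ℚ ≤ fromℕ (length ys) * (1ℚ - x) ^ t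

    greedy : ∀ ys → 0 ℕ.< length ys → Acc ℕ._<_ (length ys) → GreedyCover ys
    greedy ys 0<l (acc rs) = let (a , le) = pick ys in
      [ (λ 0<u → extend a le (greedy (uncovered a ys) 0<u (rs (uncovered-< {a} {ys} 0<l le))))
      , (λ 0≡u → finish a (sym 0≡u))
      ]′ (ℕ.m≤n⇒m<n∨m≡n (ℕ.z≤n {length (uncovered a ys)}))
      where
      all-empty : ∀ {P : B → Set} {zs} → length zs ≡ 0 → All P zs
      all-empty {zs = []} _ = []

      finish : ∀ a → length (uncovered a ys) ≡ 0 → GreedyCover ys
      -- With t = 0 the estimate reads 1 ≤ `length ys`, which is the nonemptiness of `ys`.
      finish a u≡0 = a ∷ [] , 0 , refl , covers-∷ a ys (all-empty u≡0) ,
        subst (1ℚ ≤_) (sym (ℚ.*-identityʳ (fromℕ (length ys)))) (fromℕ-mono 0<l)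

      extend : ∀ a → fromℕ (length ys) * x ≤ fromℕ (covered a ys) →
             GreedyCover (uncovered a ys) → GreedyCover ys
      extend a le (𝒞 , t , len , cov , 1≤) =
        a ∷ 𝒞 , suc t , cong suc len , covers-∷ a ys cov , decay-step {a} {ys} t le 1≤

  fromℕ-covered-∷ : ∀ a y ys → fromℕ (covered a (y ∷ ys)) ≡ 𝟙 (covers a y) + fromℕ (covered a ys)
  fromℕ-covered-∷ a y ys with covers a y
  ... | true  = fromℕ-+ 1 (covered a ys)
  ... | false = sym (ℚ.+-identityˡ _)

  -- Averaging over a fractional cover.

  module FractionalCover (as : List A) (w : A → ℚ) (0≤w : ∀ a → 0ℚ ≤ w a)
    (w-covers : ∀ y → 1ℚ ≤ sum (map (λ a → w a * 𝟙 (covers a y)) as)) where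

    -- Double counting: adding up `w-covers` over the points of `ys` and exchanging the two sums
    -- collects `covered a ys` behind each weight.
    length≤weighted : ∀ ys → fromℕ (length ys) ≤ sum (map (λ a → w a * fromℕ (covered a ys)) as)
    length≤weighted []       = sum-nonNeg (All.map⁺ (All.universal (λ a → *-nonNeg (0≤w a) ℚ.≤-refl) as))
    length≤weighted (y ∷ ys) = begin
      fromℕ (suc (length ys))
        ≡⟨ fromℕ-+ 1 (length ys) ⟩
      1ℚ + fromℕ (length ys)
        ≤⟨ ℚ.+-mono-≤ (w-covers y) (length≤weighted ys) ⟩
      sum (map (λ a → w a * 𝟙 (covers a y)) as) + sum (map (λ a → w a * fromℕ (covered a ys)) as)
        ≡⟨ sum-map-+ _ _ as ⟨
      sum (map (λ a → w a * 𝟙 (covers a y) + w a * fromℕ (covered a ys)) as)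
        ≡⟨ cong sum (List.map-cong (λ a → trans (cong (w a *_) (fromℕ-covered-∷ a y ys))
             (ℚ.*-distribˡ-+ (w a) _ _)) as) ⟨
      sum (map (λ a → w a * fromℕ (covered a (y ∷ ys))) as) ∎

    -- The weighted sum of the counts is at most the total weight times the largest count. `a₀` is
    -- the default value that makes `argmax` total.
    average : A → ∀ ys → ∃ λ a → fromℕ (length ys) ≤ sum (map w as) * fromℕ (covered a ys)
    average a₀ ys = a⁺ , (begin
      fromℕ (length ys)
        ≤⟨ length≤weighted ys ⟩
      sum (map (λ a → w a * fromℕ (covered a ys)) as)
        ≤⟨ sum-map-mono (All.map (λ {a} le → *-monoˡ-≤ (0≤w a) (fromℕ-mono le))
             (f[xs]≤f[argmax] {f = λ a → covered a ys} a₀ as)) ⟩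
      sum (map (λ a → w a * fromℕ (covered a⁺ ys)) as)
        ≡⟨ sum-map-* w (fromℕ (covered a⁺ ys)) as ⟩
      sum (map w as) * fromℕ (covered a⁺ ys) ∎)
      where a⁺ = argmax (λ a → covered a ys) a₀ as

    -- The weights of the sets covering a single point already add up to 1. This yields 1 ≤ ν, hence
    -- x ≤ 1, and later pays for the last greedy pick.
    1≤total : B → 1ℚ ≤ sum (map w as)
    1≤total y = begin
      1ℚ                                          ≤⟨ w-covers y ⟩
      sum (map (λ a → w a * 𝟙 (covers a y)) as)   ≤⟨ sum-map-mono (All.universal (λ a →
                                                       *-monoˡ-≤ (0≤w a) (𝟙≤1 (covers a y))) as) ⟩
      sum (map (λ a → w a * 1ℚ) as)               ≡⟨ cong sum (List.map-cong (λ a → ℚ.*-identityʳ (w a)) as) ⟩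
      sum (map w as)                              ∎

-- The directed balls of the cube

-- Only the number m of zeros of the centre matters: `upBallSize n R j` is definitionally
-- `ballSize (n ∸ j) R`, which permits induction on m.
ballSize : ℕ → ℕ → ℕ
ballSize m R = upBallSize m R 0

ballSize-0 : ∀ R → ballSize 0 R ≡ 1
ballSize-0 R = cong suc (trans
  (ℕ-Sum.sum-cong-≗ {R} (λ i → k>n⇒nCk≡0 {0} {suc (toℕ i)} (ℕ.s≤s ℕ.z≤n)))
  (ℕ-Sum.sum-replicate-zero R))

-- An additional zero is either kept or flipped, and flipping uses one unit of radius. Formally this
-- is Pascal's rule summed over i, with the term i = 0 split off by `cong suc`.
ballSize-suc : ∀ m R → ballSize (suc m) (suc R) ≡ ballSize m (suc R) ℕ.+ ballSize m R
ballSize-suc m R = trans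
    (cong suc (trans
      (ℕ-Sum.sum-cong-≗ {suc R} (λ i → sym (nCk+nC[k+1]≡[n+1]C[k+1] m (toℕ i))))
      (ℕ-Sum.∑-distrib-+ {suc R} (λ i → m C toℕ i) (λ i → m C suc (toℕ i)))))
    (cong suc (ℕ.+-comm (ballSize m R) _))

ballSize-step : ∀ m R → ballSize m R ℕ.≤ ballSize (suc m) R
ballSize-step m zero    = ℕ.≤-refl
ballSize-step m (suc R) = subst (ballSize m (suc R) ℕ.≤_) (sym (ballSize-suc m R)) (ℕ.m≤m+n _ _)

ballSize-mono : ∀ {l m} R → l ℕ.≤ m → ballSize l R ℕ.≤ ballSize m R
ballSize-mono {l} {m} R l≤m = go (ℕ.≤⇒≤′ l≤m)
  where
  go : ∀ {m} → l ℕ.≤′ m → ballSize l R ℕ.≤ ballSize m R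
  go (ℕ.≤′-reflexive refl)  = ℕ.≤-refl
  go {suc m} (ℕ.≤′-step le) = ℕ.≤-trans (go le) (ballSize-step m R)

0<ballSize : ∀ m R → 0 ℕ.< ballSize m R
0<ballSize m R = ℕ.s≤s ℕ.z≤n

ones : ∀ {n} → Q n → ℕ
ones = count (Bool._≟ true)

-- `R` is a budget, spent wherever `c` has a one and `y` a zero. The clauses follow the recursion in
-- `ballSize-suc`, so balls can be counted by induction.
covers : ∀ {n} → ℕ → Q n → Q n → Bool
covers R       []          []          = true
covers R       (true  ∷ c) (true  ∷ y) = covers R c y
covers R       (false ∷ c) (true  ∷ y) = false
covers R       (false ∷ c) (false ∷ y) = covers R c y
covers zero    (true  ∷ c) (false ∷ y) = false
covers (suc R) (true  ∷ c) (false ∷ y) = covers R c y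

covers⇒B⁻ : ∀ {n} R (c y : Q n) → T (covers R c y) → B⁻ c R y
covers⇒B⁻ R [] [] _ = (λ ()) , ℕ.z≤n
covers⇒B⁻ R (true ∷ c) (true ∷ y) cov = let (y≼c , d≤R) = covers⇒B⁻ R c y cov in
  (λ { zero → Bool.b≤b ; (suc i) → y≼c i }) , d≤R
covers⇒B⁻ R (false ∷ c) (false ∷ y) cov = let (y≼c , d≤R) = covers⇒B⁻ R c y cov in
  (λ { zero → Bool.b≤b ; (suc i) → y≼c i }) , d≤R
covers⇒B⁻ (suc R) (true ∷ c) (false ∷ y) cov = let (y≼c , d≤R) = covers⇒B⁻ R c y cov in
  (λ { zero → Bool.f≤t ; (suc i) → y≼c i }) , ℕ.s≤s d≤R

covers⇒ones≤ : ∀ {n} R (c y : Q n) → T (covers R c y) → ones y ℕ.≤ ones c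
covers⇒ones≤ R       []          []          _   = ℕ.z≤n
covers⇒ones≤ R       (true  ∷ c) (true  ∷ y) cov = ℕ.s≤s (covers⇒ones≤ R c y cov)
covers⇒ones≤ R       (false ∷ c) (false ∷ y) cov = covers⇒ones≤ R c y cov
covers⇒ones≤ (suc R) (true  ∷ c) (false ∷ y) cov = ℕ.m≤n⇒m≤1+n (covers⇒ones≤ R c y cov)

sum-cube-suc : ∀ n (f : Q (suc n) → ℚ) →
  sum (map f (cube (suc n))) ≡ sum (map (f ∘ (false ∷_)) (cube n)) + sum (map (f ∘ (true ∷_)) (cube n))
sum-cube-suc n f = begin-equality
  -- The trailing `[]` is the empty last step of `cartesianProductWith`.
  sum (map f (map (false ∷_) (cube n) ++ map (true ∷_) (cube n) ++ []))
    ≡⟨ cong (λ xs → sum (map f (map (false ∷_) (cube n) ++ xs))) (List.++-identityʳ _) ⟩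
  sum (map f (map (false ∷_) (cube n) ++ map (true ∷_) (cube n)))
    ≡⟨ cong sum (List.map-++ f (map (false ∷_) (cube n)) _) ⟩
  sum (map f (map (false ∷_) (cube n)) ++ map f (map (true ∷_) (cube n)))
    ≡⟨ sum-++ (map f (map (false ∷_) (cube n))) _ ⟩
  sum (map f (map (false ∷_) (cube n))) + sum (map f (map (true ∷_) (cube n)))
    ≡⟨ cong₂ (λ xs ys → sum xs + sum ys) (List.map-∘ (cube n)) (List.map-∘ (cube n)) ⟨
  sum (map (f ∘ (false ∷_)) (cube n)) + sum (map (f ∘ (true ∷_)) (cube n)) ∎

length-cube-suc : ∀ n → length (cube (suc n)) ≡ length (cube n) ℕ.+ length (cube n)
length-cube-suc n = trans (List.length-++ (map (false ∷_) (cube n)))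
  (cong₂ ℕ._+_ (List.length-map (false ∷_) (cube n))
    (trans (cong length (List.++-identityʳ (map (true ∷_) (cube n)))) (List.length-map (true ∷_) (cube n))))

sum-map-0 : ∀ {A : Set} (xs : List A) → sum (map (λ _ → 0ℚ) xs) ≡ 0ℚ
sum-map-0 []       = refl
sum-map-0 (x ∷ xs) = trans (ℚ.+-identityˡ _) (sum-map-0 xs)

-- The centres `c` counted here form the upward ball around `y`. Splitting on their first
-- coordinate, a one in `y` forces a one in `c`; a zero allows both values, and a one in `c` then
-- lowers the radius.
sum-covers : ∀ {n} R (y : Q n) →
             sum (map (λ c → 𝟙 (covers R c y)) (cube n)) ≡ fromℕ (upBallSize n R (ones y))
sum-covers {zero}  R []          = sym (cong fromℕ (ballSize-0 R))
sum-covers {suc n} R (true  ∷ y) = trans (sum-cube-suc n _)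
  (trans (cong₂ _+_ (sum-map-0 (cube n)) (sum-covers R y)) (ℚ.+-identityˡ _))
sum-covers {suc n} zero    (false ∷ y) = trans (sum-cube-suc n _)
  (trans (cong₂ _+_ (sum-covers zero y) (sum-map-0 (cube n))) (ℚ.+-identityʳ _))
sum-covers {suc n} (suc R) (false ∷ y) = trans (sum-cube-suc n _)
  (trans (cong₂ _+_ (sum-covers (suc R) y) (sum-covers R y))
    (trans (sym (fromℕ-+ (ballSize z (suc R)) (ballSize z R)))
      (cong fromℕ (trans (sym (ballSize-suc z R))
        -- As `_∸_` truncates, moving `suc` out of it requires `ones y` ≤ n.
        (cong (λ m → ballSize m (suc R)) (sym (ℕ.+-∸-assoc 1 (Vec.count≤n (Bool._≟ true) y))))))))
  where z = n ℕ.∸ ones y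

-- The weights 1 / V_j as a fractional cover.

weight : ∀ {n} → ℕ → Q n → ℚ
weight {n} R c = recip (fromℕ (upBallSize n R (ones c)))

0<fromℕ-ballSize : ∀ m R → 0ℚ < fromℕ (ballSize m R)
0<fromℕ-ballSize m R = fromℕ-pos (ballSize m R) {{ℕ.>-nonZero (0<ballSize m R)}}

weight-nonNeg : ∀ {n} R (c : Q n) → 0ℚ ≤ weight R c
weight-nonNeg {n} R c = ℚ.<⇒≤ (recip-pos _ (0<fromℕ-ballSize (n ℕ.∸ ones c) R))

weight-mono : ∀ {n} R (c y : Q n) → ones y ℕ.≤ ones c → weight R y ≤ weight R c
weight-mono {n} R c y le = recip-antitone (0<fromℕ-ballSize (n ℕ.∸ ones c) R)
  (fromℕ-mono (ballSize-mono R (ℕ.∸-monoʳ-≤ n le)))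

𝟙-*-mono : ∀ b {p q} → (T b → p ≤ q) → 𝟙 b * p ≤ q * 𝟙 b
𝟙-*-mono true  {p} {q} p≤q = subst₂ _≤_ (sym (ℚ.*-identityˡ p)) (sym (ℚ.*-identityʳ q)) (p≤q _)
𝟙-*-mono false {p} {q} _   = ℚ.≤-reflexive (trans (ℚ.*-zeroˡ p) (sym (ℚ.*-zeroʳ q)))

-- As V_j decreases in j, each of the V_|y| many c covering y has weight at least 1 / V_|y|.
weight-covers : ∀ {n} R (y : Q n) → 1ℚ ≤ sum (map (λ c → weight R c * 𝟙 (covers R c y)) (cube n))
weight-covers {n} R y = begin
  1ℚ
    ≡⟨ *-recip V (0<fromℕ-ballSize (n ℕ.∸ ones y) R) ⟨
  V * weight R y
    ≡⟨ cong (_* weight R y) (sum-covers R y) ⟨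
  sum (map (λ c → 𝟙 (covers R c y)) (cube n)) * weight R y
    ≡⟨ sum-map-* (λ c → 𝟙 (covers R c y)) (weight R y) (cube n) ⟨
  sum (map (λ c → 𝟙 (covers R c y) * weight R y) (cube n))
    ≤⟨ sum-map-mono (All.universal (λ c → 𝟙-*-mono (covers R c y)
         (λ cov → weight-mono R c y (covers⇒ones≤ R c y cov))) (cube n)) ⟩
  sum (map (λ c → weight R c * 𝟙 (covers R c y)) (cube n)) ∎
  where V = fromℕ (upBallSize n R (ones y))

-- The total weight, summed level by level.

∑-last : ∀ n (f : ℕ → ℚ) → ℚ-Sum.∑[ i ≤ n ] f (toℕ i) ≡ ℚ-Sum.∑[ i < n ] f (toℕ i) + f n
∑-last zero    f = ℚ.+-comm (f 0) 0ℚ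
∑-last (suc n) f = trans (cong (f 0 +_) (∑-last n (f ∘ suc)))
  (sym (ℚ.+-assoc (f 0) (ℚ-Sum.∑[ i < n ] f (suc (toℕ i))) (f (suc n))))

binomialSum : ℕ → (ℕ → ℚ) → ℚ
binomialSum n φ = ℚ-Sum.∑[ j ≤ n ] (fromℕ (n C toℕ j) * φ (toℕ j))

-- Pascal's rule, in the form that matches splitting the cube by its first coordinate: a leading one
-- shifts the level, hence `φ ∘ suc`.
binomialSum-suc : ∀ n φ → binomialSum (suc n) φ ≡ binomialSum n φ + binomialSum n (φ ∘ suc)
binomialSum-suc n φ = begin-equality
  φ₀ + ℚ-Sum.∑[ i ≤ n ] (fromℕ (suc n C suc (toℕ i)) * φ (suc (toℕ i)))
    ≡⟨ cong (φ₀ +_) (ℚ-Sum.sum-cong-≗ {suc n} pascal) ⟩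
  φ₀ + ℚ-Sum.∑[ i ≤ n ] (lower (toℕ i) + upper (toℕ i))
    ≡⟨ cong (φ₀ +_) (ℚ-Sum.∑-distrib-+ {suc n} (lower ∘ toℕ) (upper ∘ toℕ)) ⟩
  φ₀ + (binomialSum n (φ ∘ suc) + ℚ-Sum.∑[ i ≤ n ] upper (toℕ i))
    ≡⟨ cong (λ z → φ₀ + (binomialSum n (φ ∘ suc) + z)) drop-last ⟩
  -- The top term vanished because n C (n + 1) = 0; now `φ₀` joins the shortened sum as its term j =
  -- 0, giving `binomialSum n φ`.
  φ₀ + (binomialSum n (φ ∘ suc) + ℚ-Sum.∑[ i < n ] upper (toℕ i))
    ≡⟨ solve 3 (λ a b c → a :+ (b :+ c) := (a :+ c) :+ b) refl
         φ₀ (binomialSum n (φ ∘ suc)) (ℚ-Sum.∑[ i < n ] upper (toℕ i)) ⟩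
  binomialSum n φ + binomialSum n (φ ∘ suc) ∎
  where
  φ₀ : ℚ
  φ₀ = fromℕ 1 * φ 0
  lower upper : ℕ → ℚ
  lower i = fromℕ (n C i) * φ (suc i)
  upper i = fromℕ (n C suc i) * φ (suc i)
  pascal : ∀ i → fromℕ (suc n C suc (toℕ i)) * φ (suc (toℕ i)) ≡ lower (toℕ i) + upper (toℕ i)
  pascal i = trans
    (cong (_* φ (suc (toℕ i))) (trans (cong fromℕ (sym (nCk+nC[k+1]≡[n+1]C[k+1] n (toℕ i))))
      (fromℕ-+ (n C toℕ i) (n C suc (toℕ i)))))
    (ℚ.*-distribʳ-+ (φ (suc (toℕ i))) (fromℕ (n C toℕ i)) (fromℕ (n C suc (toℕ i))))
  upper-n : upper n ≡ 0ℚ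
  upper-n = trans (cong (λ m → fromℕ m * φ (suc n)) (k>n⇒nCk≡0 (ℕ.n<1+n n))) (ℚ.*-zeroˡ (φ (suc n)))
  drop-last : ℚ-Sum.∑[ i ≤ n ] upper (toℕ i) ≡ ℚ-Sum.∑[ i < n ] upper (toℕ i)
  drop-last = trans (∑-last n upper) (trans (cong (∑< +_) upper-n) (ℚ.+-identityʳ ∑<))
    where ∑< = ℚ-Sum.∑[ i < n ] upper (toℕ i)

-- Level j has n C j points. Rather than counting them, the proof shows that both sides satisfy the
-- same recursion in n.
sum-by-ones : ∀ n φ → sum (map (φ ∘ ones) (cube n)) ≡ binomialSum n φ
sum-by-ones zero    φ = cong (_+ 0ℚ) (sym (ℚ.*-identityˡ (φ 0)))
sum-by-ones (suc n) φ = trans (sum-cube-suc n (φ ∘ ones))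
  (trans (cong₂ _+_ (sum-by-ones n φ) (sum-by-ones n (φ ∘ suc))) (sym (binomialSum-suc n φ)))

-- Reconciles the division in `ν` with the `recip` in `weight`.
/-as-recip : ∀ a n .{{_ : ℕ.NonZero n}} → fromℕ a * recip (fromℕ n) ≡ ℤ.+ a / n
/-as-recip a n = begin-equality
  fromℕ a * recip (fromℕ n)                   ≡⟨ cong (_* recip (fromℕ n)) (fromℕ-*-/ a n) ⟨
  (fromℕ n * (ℤ.+ a / n)) * recip (fromℕ n)   ≡⟨ solve 3 (λ n q r → (n :* q) :* r := (n :* r) :* q) refl
                                                   (fromℕ n) (ℤ.+ a / n) (recip (fromℕ n)) ⟩
  (fromℕ n * recip (fromℕ n)) * (ℤ.+ a / n)   ≡⟨ cong (_* (ℤ.+ a / n)) (*-recip (fromℕ n) (fromℕ-pos n)) ⟩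
  1ℚ * (ℤ.+ a / n)                            ≡⟨ ℚ.*-identityˡ _ ⟩
  ℤ.+ a / n                                   ∎

sum-weight : ∀ n R → sum (map (weight R) (cube n)) ≡ ν n R
sum-weight n R = trans (sum-by-ones n (λ j → recip (fromℕ (upBallSize n R j))))
  (ℚ-Sum.sum-cong-≗ {suc n} (λ j → /-as-recip (n C toℕ j) (upBallSize n R (toℕ j))))

-- From the greedy cover to the bound on K⁺.

growth-copies : ∀ n {as} → growth as ≡ 1ℚ + 1ℚ →
                growth (concat (replicate n as)) ≡ fromℕ (length (cube n))
growth-copies zero    eq = refl
growth-copies (suc n) {as} eq = begin-equality
  growth (as ++ concat (replicate n as))       ≡⟨ growth-++ as _ ⟩
  growth as * growth (concat (replicate n as)) ≡⟨ cong₂ _*_ eq (growth-copies n eq) ⟩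
  (1ℚ + 1ℚ) * l                                  ≡⟨ solve 1 (λ l → (con 1ℚ :+ con 1ℚ) :* l := l :+ l) refl l ⟩
  l + l                                          ≡⟨ fromℕ-+ (length (cube n)) (length (cube n)) ⟨
  fromℕ (length (cube n) ℕ.+ length (cube n))    ≡⟨ cong fromℕ (length-cube-suc n) ⟨
  fromℕ (length (cube (suc n)))                  ∎
  where l = fromℕ (length (cube n))

0<length-cube : ∀ n → 0 ℕ.< length (cube n)
0<length-cube zero    = ℕ.s≤s ℕ.z≤n
0<length-cube (suc n) = subst (0 ℕ.<_) (sym (length-cube-suc n)) (ℕ.<-≤-trans (0<length-cube n) (ℕ.m≤m+n _ _))

-- `K⁺` is a minimum over duplicate-free lists, so repetitions are removed first; this keeps the
-- covering property and does not lengthen the list.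
K⁺≤length : ∀ {n R} (𝒞 : List (Q n)) → DownwardCovers R 𝒞 → K⁺ n R ℕ.≤ length 𝒞
K⁺≤length {n} {R} 𝒞 cov = ℕ.≤-trans
  (proj₂ (proj₂ (minimumCover n R)) _
    (deduplicate _≟_ 𝒞 , refl , deduplicate-! _≟_ 𝒞 ,
     λ y → Any.deduplicate⁺ _≟_ (λ { refl p → p }) (cov y)))
  (List.length-deduplicate _≟_ 𝒞)
  where _≟_ = Vec.≡-dec Bool._≟_

module _ (n R : ℕ) where

  private
    x : ℚ
    x = recip (ν n R)

    module Fractional = FractionalCover (covers {n} R) (cube n) (weight R) (weight-nonNeg R) (weight-covers R)

    y₀ : Q n
    -- An arbitrary point, witnessing that the cube is nonempty.
    y₀ = Vec.replicate n true

    1≤ν : 1ℚ ≤ ν n R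
    1≤ν = subst (1ℚ ≤_) (sum-weight n R) (Fractional.1≤total y₀)

    ν*x≡1 : ν n R * x ≡ 1ℚ
    ν*x≡1 = *-recip (ν n R) (1≤p⇒0<p 1≤ν)

    0<x : 0ℚ < x
    0<x = recip-pos (ν n R) (1≤p⇒0<p 1≤ν)

    pick : ∀ ys → ∃ λ c → fromℕ (length ys) * x ≤ fromℕ (covered (covers R) c ys)
    pick ys = let (c , le) = Fractional.average y₀ ys; k = fromℕ (covered (covers R) c ys) in c , (begin
      fromℕ (length ys) * x   ≤⟨ *-monoʳ-≤ (ℚ.<⇒≤ 0<x) le ⟩
      (sum (map (weight R) (cube n)) * k) * x
                              ≡⟨ cong (λ s → (s * k) * x) (sum-weight n R) ⟩
      (ν n R * k) * x         ≡⟨ solve 3 (λ v k x → (v :* k) :* x := (v :* x) :* k) refl (ν n R) k x ⟩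
      (ν n R * x) * k         ≡⟨ cong (_* k) ν*x≡1 ⟩
      1ℚ * k                  ≡⟨ ℚ.*-identityˡ k ⟩
      k                       ∎)

  module Cover = Greedy (covers {n} R) 0<x (recip-≤1 1≤ν) pick

  K⁺-bound : ∃ λ t → K⁺ n R ℕ.≤ suc t × 1ℚ ≤ fromℕ (length (cube n)) * (1ℚ - x) ^ t
  K⁺-bound = let (𝒞 , t , len , cov , 1≤) = Cover.greedy (cube n) (0<length-cube n) (<-wellFounded _) in
    t ,
    subst (K⁺ n R ℕ.≤_) len (K⁺≤length 𝒞 (λ y → Any.map (λ {c} → covers⇒B⁻ R c y) (All.lookup cov (∈-cube y)))) ,
    1≤

  -- Each Riemann sum satisfies the bound exactly, with no error term, since its own terms are the
  -- excesses in a factorisation of 2. The number t comes from the greedy cover and does not depend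
  -- on k.
  K⁺≤logSeq : ∀ k → fromℕ (K⁺ n R) ≤ (fromℕ n * logSeq (fromℕ 2) k + 1ℚ) * ν n R
  K⁺≤logSeq k = let (t , K⁺≤1+t , 1≤) = K⁺-bound in begin
    fromℕ (K⁺ n R)                        ≤⟨ fromℕ-mono K⁺≤1+t ⟩
    fromℕ (suc t)                         ≡⟨ fromℕ-+ 1 t ⟩
    1ℚ + fromℕ t                          ≡⟨ cong (1ℚ +_) (ℚ.*-identityʳ (fromℕ t)) ⟨
    1ℚ + fromℕ t * 1ℚ                     ≡⟨ cong (λ z → 1ℚ + fromℕ t * z) ν*x≡1 ⟨
    1ℚ + fromℕ t * (ν n R * x)            ≡⟨ solve 3 (λ t v x → con 1ℚ :+ t :* (v :* x) :=
                                               con 1ℚ :+ (t :* x) :* v) refl (fromℕ t) (ν n R) x ⟩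
    -- The summand 1, which counts the last pick, is absorbed by 1 ≤ ν.
    1ℚ + (fromℕ t * x) * ν n R            ≤⟨ ℚ.+-mono-≤ 1≤ν (*-monoʳ-≤ (ℚ.≤-trans 0≤1 1≤ν) (t*x≤ t 1≤)) ⟩
    ν n R + (fromℕ n * L) * ν n R         ≡⟨ solve 3 (λ n l v → v :+ (n :* l) :* v :=
                                               (n :* l :+ con 1ℚ) :* v) refl (fromℕ n) L (ν n R) ⟩
    (fromℕ n * L + 1ℚ) * ν n R            ∎
    where
    open LogTwo k
    L = logSeq (fromℕ 2) k
    -- n copies of the factors of 2, whose product is 2ⁿ, the number of points to cover.
    as = concat (replicate n increments)
    t*x≤ : ∀ t → 1ℚ ≤ fromℕ (length (cube n)) * (1ℚ - x) ^ t → fromℕ t * x ≤ fromℕ n * L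
    t*x≤ t 1≤ = begin
      fromℕ t * x               ≤⟨ growth-decay (ℚ.<⇒≤ 0<x) (recip-≤1 1≤ν) as t
                                     (All.concat⁺ (All.replicate⁺ n increments-nonNeg))
                                     (subst (λ z → 1ℚ ≤ z * (1ℚ - x) ^ t)
                                       (sym (growth-copies n growth-increments)) 1≤) ⟩
      sum as                    ≡⟨ sum-copies n increments ⟩
      fromℕ n * sum increments  ≡⟨ cong (fromℕ n *_) sum-increments ⟩
      fromℕ n * L               ∎

proposition10 : ∀ (n R : ℕ) →
    fromℚ (fromℕ (K⁺ n R)) ≤ℝ
    (fromℚ (fromℕ n) *ℝ log (fromℕ 2) +ℝ fromℚ 1ℚ) *ℝ fromℚ (ν n R)
-- The two sequences compare termwise from index 0 on, and adding ε > 0 keeps the inequality.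
proposition10 n R ε 0<ε = 0 , λ k _ → ℚ.≤-trans (K⁺≤logSeq n R k)
  (subst (_≤ rhs k + ε) (ℚ.+-identityʳ (rhs k)) (ℚ.+-monoʳ-≤ (rhs k) (ℚ.<⇒≤ 0<ε)))
  where
  rhs : ℕ → ℚ
  rhs k = (fromℕ n * logSeq (fromℕ 2) k + 1ℚ) * ν n R
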